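{- Let $n = 2^k$. Then ExternalWeakHeapsort performs exactly the same comparisons as top-down Mergesort applied to a fixed permutation of the same input array; that is, there is a permutation $\pi$ of $\{0,\dots,n-1\}$, depending only on $n$, such that for every array $s_0,\dots,s_{n-1}$ of pairwise distinct elements, ExternalWeakHeapsort on $s$ performs exactly the same comparisons as top-down Mergesort on $(s_{\pi(0)},\dots,s_{\pi(n-1)})$.
   Context: Weak heap: array $s_0,\dots,s_{n-1}$ with reverse bits $r_0,\dots,r_{n-1}\in\{0,1\}$. The left child of index $i$ is $2i+r_i$, the right child is $2i+1-r_i$, the parent of $i\neq 0$ is $\lfloor i/2\rfloor$; the root $0$ has no left child. The weak-heap order requires each node's element to be $\le$ every element in its right subtree. The distinguished ancestor d-ancestor$(j)$ of $j\ne 0$ is the parent of $j$ if $j$ is a right child, and d-ancestor of the parent of $j$ if $j$ is a left child. join$(i,j)$: compare $s_j$ with $s_i$; if $s_j<s_i$, swap $s_i,s_j$ and set $r_j\leftarrow 1-r_j$. Construction: with all $r_i=0$, for $j=n-1$ down to $1$ perform join(d-ancestor$(j)$, $j$) ($n-1$ comparisons). ExternalWeakHeapsort: after construction, additionally maintain active bits (initially all true; inactive nodes are considered removed). Until the heap is empty: move the root element to the next position of a separate output array, and fill the hole at the root as follows (hole filling at a node $v$ that roots a weak heap): follow the special path from $v$, going once to the right child and then to left children as far as possible (among active nodes), reaching a node $x$ without left child (no comparisons needed); move $s_x$ to $v$; if $x$ has a right subtree, fill the hole at $x$ recursively in the weak heap rooted at $x$, otherwise set the active bit of $x$ to false; then,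 going upwards along the special path, join each node $y$ on the special path strictly between $v$ and $x$ with its distinguished ancestor $v$ (i.e. perform join$(v,y)$ from the bottommost such $y$ to the topmost). Top-down Mergesort on an array of length $m>1$: recursively sort the left half and the right half, then merge them by repeatedly comparing the smallest remaining elements of both halves and moving the smaller one to the output, until one half is exhausted. -}

module Defs where

open import Data.Bool.Base using (Bool; true; false; not; if_then_else_)
open import Data.Fin.Base as Fin using (Fin; zero; suc; toℕ; fromℕ<)
open import Data.Fin.Induction using (>-wellFounded) renaming (<-wellFounded to Fin-<-wellFounded)
open import Data.Fin.Properties using (toℕ<n; toℕ-fromℕ<)
open import Data.List.Base as List using (List; []; _∷_; _∷ʳ_; _++_; length; take; drop; foldr)
open import Data.List.Properties using (length-take; length-drop)
open import Data.Maybe.Base using (Maybe; just; nothing)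
open import Data.Nat.Base using (ℕ; zero; suc; _+_; _*_; _∸_; _≤_; _<_; _≡ᵇ_; ⌊_/2⌋; s≤s)
open import Data.Nat.Induction using (<-wellFounded)
open import Data.Nat.Properties
  using (_<?_; ≤-refl; ≤-trans; <-≤-trans; <⇒≤; ≤-<-trans; m⊓n≤m; m∸n≤m; ⌊n/2⌋≤n; ⌊n/2⌋<n)
open import Data.Product.Base using (_×_; _,_; proj₂; ∃; swap)
open import Data.Product.Relation.Binary.Pointwise.NonDependent using (Pointwise)
open import Data.Sum.Base using (_⊎_)
open import Data.Vec.Base using (Vec; lookup; replicate; tabulate; _[_]≔_; _[_]%=_)
open import Data.Vec.Functional using (Vector)
import Data.List.Relation.Binary.Permutation.Homogeneous as Homogeneous
open import Induction.WellFounded using (Acc; acc)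
open import Level using (_⊔_)
open import Relation.Binary.Bundles using (StrictTotalOrder)
open import Relation.Binary.Core using (Rel)
open import Relation.Binary.PropositionalEquality using (subst; sym)
open import Relation.Nullary.Decidable.Core using (yes; no; does)

private variable
  n : ℕ

bit : Bool → ℕ
bit b = if b then 1 else 0

leftIndex rightIndex : Vec Bool n → Fin n → ℕ
leftIndex  r i = 2 * toℕ i + bit (lookup r i)
rightIndex r i = 2 * toℕ i + 1 ∸ bit (lookup r i)

parent : Fin n → Fin n
parent j = fromℕ< (≤-<-trans (⌊n/2⌋≤n (toℕ j)) (toℕ<n j))

parent-< : (i : Fin n) → parent (suc i) Fin.< suc i
parent-< i = subst (_< suc (toℕ i)) (sym (toℕ-fromℕ< _)) (⌊n/2⌋<n (toℕ i))

-- The value at the root is a dummy: the root has no distinguished ancestor.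
dAncestorAcc : Vec Bool n → (j : Fin n) → Acc Fin._<_ j → Fin n
dAncestorAcc r zero      _        = zero
dAncestorAcc r j@(suc i) (acc rs) =
  if toℕ j ≡ᵇ rightIndex r (parent j)
  then parent j
  else dAncestorAcc r (parent j) (rs (parent-< i))

dAncestor : Vec Bool n → Fin n → Fin n
dAncestor r j = dAncestorAcc r j (Fin-<-wellFounded j)

module _ {a ℓ₁ ℓ₂} (O : StrictTotalOrder a ℓ₁ ℓ₂) where

  open StrictTotalOrder O using (_≈_) renaming (Carrier to A; _<?_ to _<ᴬ?_)

  -- A comparison is recorded as the pair of elements compared; which of the
  -- two is named first is immaterial.
  Comparison : Set a
  Comparison = A × A

  _≈ᶜ_ : Rel Comparison ℓ₁
  p ≈ᶜ q = Pointwise _≈_ _≈_ p q ⊎ Pointwise _≈_ _≈_ (swap p) q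

  -- Equality of multisets of unordered pairs.  The two algorithms perform
  -- their comparisons in different chronological orders.
  SameComparisons : Rel (List Comparison) (a ⊔ ℓ₁)
  SameComparisons = Homogeneous.Permutation _≈ᶜ_

  ----------------------------------------------------------------------
  -- ExternalWeakHeapsort

  record State (n : ℕ) : Set a where
    field
      elements    : Vec A n
      reverseBits : Vec Bool n
      active      : Vec Bool n
      output      : List A
      comparisons : List Comparison

  open State

  join : Fin n → Fin n → State n → State n
  join i j S = record
    { elements    = if less then elements S [ i ]≔ sⱼ [ j ]≔ sᵢ else elements S
    ; reverseBits = if less then reverseBits S [ j ]%= not else reverseBits S
    ; active      = active S
    ; output      = output S
    ; comparisons = comparisons S ∷ʳ (sⱼ , sᵢ)
    }
    where
    sᵢ sⱼ : A
    sᵢ = lookup (elements S) i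
    sⱼ = lookup (elements S) j
    less : Bool
    less = does (sⱼ <ᴬ? sᵢ)

  initial : Vector A n → State n
  initial s = record
    { elements    = tabulate s
    ; reverseBits = replicate _ false
    ; active      = replicate _ true
    ; output      = []
    ; comparisons = []
    }

  -- The right fold treats the indices n-1, …, 1 in descending order.
  construct : ∀ {m} → State (suc m) → State (suc m)
  construct {m} S =
    foldr (λ j T → join (dAncestor (reverseBits T) j) j T) S (List.tabulate {n = m} suc)

  -- The active child of v with computed index c, if there is one.  The test
  -- v < c fails only for the index 2·0 + 0 of the nonexistent left child of
  -- the root (whose reverse bit is never changed).
  child : State n → (v : Fin n) → ℕ → Maybe (∃ λ (c : Fin n) → v Fin.< c)
  child {n} S v c with toℕ v <? c | c <? n
  ... | yes v<c | yes c<n =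
    if lookup (active S) (fromℕ< c<n)
    then just (fromℕ< c<n , subst (toℕ v <_) (sym (toℕ-fromℕ< c<n)) v<c)
    else nothing
  ... | _ | _ = nothing

  leftChild rightChild : State n → (v : Fin n) → Maybe (∃ λ (c : Fin n) → v Fin.< c)
  leftChild  S v = child S v (leftIndex  (reverseBits S) v)
  rightChild S v = child S v (rightIndex (reverseBits S) v)

  -- The path from c along left children, top to bottom: all nodes but the
  -- last, and the last node x.
  leftPath : State n → (c : Fin n) → Acc Fin._>_ c →
             List (Fin n) × ∃ λ (x : Fin n) → c Fin.≤ x
  leftPath S c (acc rs) with leftChild S c
  ... | nothing        = [] , c , ≤-refl
  ... | just (d , c<d) =
    let ys , x , d≤x = leftPath S d (rs c<d)
    in c ∷ ys , x , ≤-trans (<⇒≤ c<d) d≤x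

  moveElement : (from to : Fin n) → State n → State n
  moveElement x v S = record S { elements = elements S [ v ]≔ lookup (elements S) x }

  deactivate : Fin n → State n → State n
  deactivate v S = record S { active = active S [ v ]≔ false }

  -- A node without right subtree is deactivated here rather than before the
  -- recursive call; this also covers the root when it is the last active node.
  -- The right fold performs the joins from the bottommost node to the topmost.
  fillHoleAcc : (v : Fin n) → Acc Fin._>_ v → State n → State n
  fillHoleAcc v (acc rs) S with rightChild S v
  ... | nothing        = deactivate v S
  ... | just (c , v<c) =
    let ys , x , c≤x = leftPath S c (>-wellFounded c)
    in foldr (join v) (fillHoleAcc x (rs (<-≤-trans v<c c≤x)) (moveElement x v S)) ys

  fillHole : Fin n → State n → State n
  fillHole v = fillHoleAcc v (>-wellFounded v)

  outputRoot : ∀ {m} → State (suc m) → State (suc m)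
  outputRoot S = record S { output = output S ∷ʳ lookup (elements S) zero }

  -- The first argument bounds the number of rounds.
  extractAll : ∀ {m} → ℕ → State (suc m) → State (suc m)
  extractAll zero       S = S
  extractAll (suc fuel) S =
    if lookup (active S) zero
    then extractAll fuel (fillHole zero (outputRoot S))
    else S

  -- Every round deactivates exactly one node, so n rounds empty the heap.
  externalWeakHeapsort : Vector A n → State n
  externalWeakHeapsort {zero}  s = initial s
  externalWeakHeapsort {suc m} s = extractAll (suc m) (construct (initial s))

  weakHeapsortComparisons : Vector A n → List Comparison
  weakHeapsortComparisons s = comparisons (externalWeakHeapsort s)

  ----------------------------------------------------------------------
  -- Top-down Mergesort, returning the sorted list and the comparisons made

  merge : List A → List A → List A × List Comparison
  merge []       ys       = ys , []
  merge (x ∷ xs) []       = x ∷ xs , []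
  merge (x ∷ xs) (y ∷ ys) =
    if does (y <ᴬ? x)
    then (let zs , cs = merge (x ∷ xs) ys in y ∷ zs , (y , x) ∷ cs)
    else (let zs , cs = merge xs (y ∷ ys) in x ∷ zs , (y , x) ∷ cs)

  private
    half : List A → ℕ
    half xs = ⌊ length xs /2⌋

    take-half-< : ∀ x y (zs : List A) → let xs = x ∷ y ∷ zs in
                  length (take (half xs) xs) < length xs
    take-half-< x y zs =
      subst (_< length xs) (sym (length-take (half xs) xs))
        (≤-<-trans (m⊓n≤m (half xs) (length xs)) (⌊n/2⌋<n (length (y ∷ zs))))
      where xs = x ∷ y ∷ zs

    drop-half-< : ∀ x y (zs : List A) → let xs = x ∷ y ∷ zs in
                  length (drop (half xs) xs) < length xs
    drop-half-< x y zs =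
      s≤s (subst (_≤ length (y ∷ zs))
             (sym (length-drop ⌊ length zs /2⌋ (y ∷ zs)))
             (m∸n≤m (length (y ∷ zs)) ⌊ length zs /2⌋))

  mergesortAcc : (xs : List A) → Acc _<_ (length xs) → List A × List Comparison
  mergesortAcc []               _        = [] , []
  mergesortAcc (x ∷ [])         _        = x ∷ [] , []
  mergesortAcc xs@(x ∷ y ∷ zs) (acc rs) =
    let ls , cs₁ = mergesortAcc (take (half xs) xs) (rs (take-half-< x y zs))
        us , cs₂ = mergesortAcc (drop (half xs) xs) (rs (drop-half-< x y zs))
        ws , cs₃ = merge ls us
    in ws , cs₁ ++ cs₂ ++ cs₃

  mergesort : Vector A n → List A × List Comparison
  mergesort s = mergesortAcc (List.tabulate s) (<-wellFounded _)

  mergesortComparisons : Vector A n → List Comparison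
  mergesortComparisons s = proj₂ (mergesort s)

{-# OPTIONS --safe #-}
module Submission where

-- A heap with root v and slot tree T is read as a lazily evaluated mergesort.
-- If T = node L c R, the heap is the merge of the heaps (v; L) and (c; R), where
-- the comparison that decided its minimum, the element at v, has already been made.
-- Thus `join v c` makes the first comparison of a merge and then swaps the two
-- heaps if necessary, so that the minimum always comes from (v; L).  Filling the
-- hole at v recomputes the minimum of (v; L), whose root is v as well, and compares
-- it with the element at c; once (v; L) is exhausted, the remaining elements of
-- (c; R) move up without a comparison, as in merge.  Hence the comparisons made
-- together with those still pending are invariant, and they are those of the
-- mergesort whose inputs are in the symmetric order (the root first, then
-- L, c, R) of the initial heap; this order is the permutation π.

open import Defs
open import Data.Bool.Base using (Bool; true; false; not; if_then_else_)
open import Data.Fin.Base as Fin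
  using (Fin; zero; suc; toℕ; fromℕ<; _↑ˡ_; _↑ʳ_; combine; remQuot; punchOut)
open import Data.Fin.Induction using (>-wellFounded)
open import Data.Fin.Permutation using (Permutation′; permutation; _⟨$⟩ʳ_)
import Data.Fin.Properties as Finₚ
open import Data.List.Base as List
  using (List; []; _∷_; _∷ʳ_; _++_; [_]; length; foldr; take; drop)
open import Data.List.Properties
  using (length-++; ++-assoc; ++-identityʳ; length-tabulate; tabulate-cong)
import Data.List.Relation.Binary.Permutation.Setoid as SetoidPermutation
import Data.List.Relation.Binary.Permutation.Setoid.Properties as SetoidPermutationₚ
open import Data.List.Relation.Binary.Pointwise.Base using (Pointwise; []; _∷_)
open import Data.List.Relation.Unary.All as All using (All; []; _∷_)
import Data.List.Relation.Unary.All.Properties as Allₚ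
open import Data.List.Relation.Unary.AllPairs as AllPairs using (AllPairs; []; _∷_)
import Data.List.Relation.Unary.AllPairs.Properties as AllPairsₚ
open import Data.Maybe.Base using (just; nothing)
open import Data.Nat.Base
  using (ℕ; zero; suc; _+_; _*_; _^_; _∸_; _<_; _≤_; s≤s; z≤n; s≤s⁻¹; _≡ᵇ_; ⌊_/2⌋; NonZero)
open import Data.Nat.DivMod using (_mod_; m<n⇒m%n≡m)
import Data.Nat.Properties as ℕₚ
open import Data.Nat.Properties using (≤-refl; ≤-trans; <-≤-trans; <⇒≤; <-trans; +-identityʳ)
open import Data.Nat.Tactic.RingSolver using (solve-∀)
open import Data.Product.Base using (∃; _×_; _,_; proj₁; proj₂)
open import Data.Sum.Base using (inj₁; inj₂)
open import Data.Vec.Base using (Vec; lookup; _[_]≔_; _[_]%=_; replicate; tabulate)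
open import Data.Vec.Functional using (Vector)
open import Data.Vec.Properties
  using (lookup∘update; lookup∘update′; lookup∘updateAt; lookup∘updateAt′; lookup∘tabulate;
         lookup-replicate)
open import Function.Base using (_∘_)
open import Function.Definitions using (Injective)
open import Induction.WellFounded using (Acc; acc)
open import Level using (Level; _⊔_)
open import Relation.Binary.Bundles using (Setoid; StrictTotalOrder)
open import Relation.Binary.Core using (Rel)
open import Relation.Binary.Definitions using (tri<; tri≈; tri>)
open import Relation.Binary.PropositionalEquality
  using (_≡_; _≢_; refl; sym; trans; cong; cong₂; subst; subst₂; ≢-sym)
open import Relation.Nullary using (¬_; yes; no; does; contradiction)
open import Relation.Nullary.Decidable using (dec-true; dec-false)

private variable
  a ℓ ℓ₁ ℓ₂ : Level
  A : Set a
  m n : ℕ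

-- Merging lists of distinct elements.

AllPairs-++⁻ : ∀ {R : Rel A ℓ} xs {ys} → AllPairs R (xs ++ ys) →
               AllPairs R xs × AllPairs R ys × All (λ x → All (R x) ys) xs
AllPairs-++⁻ []       rs       = [] , rs , []
AllPairs-++⁻ (x ∷ xs) (r ∷ rs) with AllPairs-++⁻ xs rs
... | rxs , rys , rxys = Allₚ.++⁻ˡ xs r ∷ rxs , rys , Allₚ.++⁻ʳ xs r ∷ rxys

module Merging (O : StrictTotalOrder a ℓ₁ ℓ₂) where

  open StrictTotalOrder O using (_≈_; _<?_; compare; asym; module Eq) renaming (Carrier to V)

  Distinct : List V → Set _
  Distinct = AllPairs (λ x y → ¬ x ≈ y)

  Apart : Rel (List V) _
  Apart xs ys = All (λ x → All (λ y → ¬ x ≈ y) ys) xs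

  ≈ᶜ-refl : ∀ {p} → _≈ᶜ_ O p p
  ≈ᶜ-refl = inj₁ (Eq.refl , Eq.refl)

  ≈ᶜ-sym : ∀ {p q} → _≈ᶜ_ O p q → _≈ᶜ_ O q p
  ≈ᶜ-sym (inj₁ (e , f)) = inj₁ (Eq.sym e , Eq.sym f)
  ≈ᶜ-sym (inj₂ (e , f)) = inj₂ (Eq.sym f , Eq.sym e)

  ≈ᶜ-trans : ∀ {p q r} → _≈ᶜ_ O p q → _≈ᶜ_ O q r → _≈ᶜ_ O p r
  ≈ᶜ-trans (inj₁ (e , f)) (inj₁ (g , h)) = inj₁ (Eq.trans e g , Eq.trans f h)
  ≈ᶜ-trans (inj₁ (e , f)) (inj₂ (g , h)) = inj₂ (Eq.trans f g , Eq.trans e h)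
  ≈ᶜ-trans (inj₂ (e , f)) (inj₁ (g , h)) = inj₂ (Eq.trans e g , Eq.trans f h)
  ≈ᶜ-trans (inj₂ (e , f)) (inj₂ (g , h)) = inj₁ (Eq.trans f g , Eq.trans e h)

  comparisonSetoid : Setoid _ _
  comparisonSetoid = record
    { _≈_           = _≈ᶜ_ O
    ; isEquivalence = record { refl = ≈ᶜ-refl ; sym = ≈ᶜ-sym ; trans = ≈ᶜ-trans }
    }

  open SetoidPermutation comparisonSetoid using (_↭_) public

  mergeValues : List V → List V → List V
  mergeValues xs ys = proj₁ (merge O xs ys)

  mergeComparisons : List V → List V → List (Comparison O)
  mergeComparisons xs ys = proj₂ (merge O xs ys)

  merge-[] : ∀ xs → merge O xs [] ≡ (xs , [])
  merge-[] []       = refl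
  merge-[] (x ∷ xs) = refl

  merge-∷ˡ : ∀ x xs y ys → does (y <? x) ≡ false →
             merge O (x ∷ xs) (y ∷ ys) ≡
             (x ∷ mergeValues xs (y ∷ ys) , (y , x) ∷ mergeComparisons xs (y ∷ ys))
  merge-∷ˡ x xs y ys eq rewrite eq = refl

  merge-∷ʳ : ∀ x xs y ys → does (y <? x) ≡ true →
             merge O (x ∷ xs) (y ∷ ys) ≡
             (y ∷ mergeValues (x ∷ xs) ys , (y , x) ∷ mergeComparisons (x ∷ xs) ys)
  merge-∷ʳ x xs y ys eq rewrite eq = refl

  private
    module V  = SetoidPermutation Eq.setoid
    module Vₚ = SetoidPermutationₚ Eq.setoid

  mergeValues-↭ : ∀ xs ys → mergeValues xs ys V.↭ xs ++ ys
  mergeValues-↭ []       ys       = V.↭-refl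
  mergeValues-↭ (x ∷ xs) []       = V.↭-sym (Vₚ.++-identityʳ (x ∷ xs))
  mergeValues-↭ (x ∷ xs) (y ∷ ys) = step (mergeValues-↭ (x ∷ xs) ys) (mergeValues-↭ xs (y ∷ ys))
    where
    step : mergeValues (x ∷ xs) ys V.↭ x ∷ xs ++ ys →
           mergeValues xs (y ∷ ys) V.↭ xs ++ y ∷ ys →
           mergeValues (x ∷ xs) (y ∷ ys) V.↭ x ∷ xs ++ y ∷ ys
    step p q with y <? x
    ... | yes _ = V.↭-trans (V.↭-prep y p) (V.↭-sym (Vₚ.↭-shift (x ∷ xs) ys))
    ... | no _  = V.↭-prep x q

  -- Merging permutes its inputs, so it suffices to carry distinctness of the final merged list;
  -- what the inner merges need is recovered from it.
  Distinct-merge⁻ : ∀ xs ys → Distinct (mergeValues xs ys) →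
                    Distinct xs × Distinct ys × Apart xs ys
  Distinct-merge⁻ xs ys d = AllPairs-++⁻ xs (Vₚ.Unique-resp-↭ (mergeValues-↭ xs ys) d)

  MergesAlike : Rel (List V) _
  MergesAlike xs ys =
    mergeValues xs ys ≡ mergeValues ys xs ×
    Pointwise (_≈ᶜ_ O) (mergeComparisons xs ys) (mergeComparisons ys xs)

  -- `merge` is asymmetric only in ties, which `Apart` excludes. Both runs then choose the same
  -- element at each step, and the recorded pairs are swapped, whence `inj₂`.
  merge-comm : ∀ xs ys → Apart xs ys → MergesAlike xs ys
  merge-comm []       ys       _ rewrite merge-[] ys = refl , []
  merge-comm (x ∷ xs) []       _ = refl , []
  merge-comm (x ∷ xs) (y ∷ ys) ((x≉y ∷ x≉ys) ∷ xs≉) =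
    step (merge-comm (x ∷ xs) ys (x≉ys ∷ All.map All.tail xs≉)) (merge-comm xs (y ∷ ys) xs≉)
    where
    step : MergesAlike (x ∷ xs) ys → MergesAlike xs (y ∷ ys) → MergesAlike (x ∷ xs) (y ∷ ys)
    step (vs , cs) (vs′ , cs′) with y <? x | x <? y
    ... | yes y<x | yes x<y = contradiction x<y (asym y<x)
    ... | yes _   | no _    = cong (y ∷_) vs , inj₂ (Eq.refl , Eq.refl) ∷ cs
    ... | no _    | yes _   = cong (x ∷_) vs′ , inj₂ (Eq.refl , Eq.refl) ∷ cs′
    ... | no y≮x  | no x≮y with compare x y
    ...   | tri< x<y _ _ = contradiction x<y x≮y
    ...   | tri≈ _ x≈y _ = contradiction x≈y x≉y
    ...   | tri> _ _ y<x = contradiction y<x y≮x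

-- Trees of heap indices and their embedding in the array.

-- Labels are array indices, not elements, and left and right are meant after the reverse bits. A
-- heap is a root index together with such a tree hanging at its right child.
data Tree (n : ℕ) : Set where
  leaf : Tree n
  node : Tree n → Fin n → Tree n → Tree n

data _∈_ {n} (j : Fin n) : Tree n → Set where
  here    : ∀ {L R} → j ∈ node L j R
  inLeft  : ∀ {L c R} → j ∈ L → j ∈ node L c R
  inRight : ∀ {L c R} → j ∈ R → j ∈ node L c R

_∉_ : Fin n → Tree n → Set
j ∉ T = ¬ j ∈ T

Disjoint : Tree n → Tree n → Set
Disjoint T U = ∀ {j} → j ∈ T → j ∉ U

∉node : ∀ {j c : Fin n} {L R} → j ≢ c → j ∉ L → j ∉ R → j ∉ node L c R
∉node j≢c j∉L j∉R here         = j≢c refl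
∉node j≢c j∉L j∉R (inLeft j∈)  = j∉L j∈
∉node j≢c j∉L j∉R (inRight j∈) = j∉R j∈

∈∧∉⇒≢ : ∀ {j c : Fin n} {T} → j ∈ T → c ∉ T → j ≢ c
∈∧∉⇒≢ j∈T c∉T refl = c∉T j∈T

leftIndex-flip : ∀ (r : Vec Bool n) c → leftIndex (r [ c ]%= not) c ≡ rightIndex r c
leftIndex-flip r c rewrite lookup∘updateAt c {not} r with lookup r c
... | false = refl
... | true  = trans (+-identityʳ _) (sym (ℕₚ.m+n∸n≡m _ 1))

rightIndex-flip : ∀ (r : Vec Bool n) c → rightIndex (r [ c ]%= not) c ≡ leftIndex r c
rightIndex-flip r c rewrite lookup∘updateAt c {not} r with lookup r c
... | false = trans (ℕₚ.m+n∸n≡m _ 1) (sym (+-identityʳ _))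
... | true  = refl

leftIndex-cong : ∀ (r r′ : Vec Bool n) {c} → lookup r c ≡ lookup r′ c →
                 leftIndex r c ≡ leftIndex r′ c
leftIndex-cong _ _ {c} eq = cong (λ b → 2 * toℕ c + bit b) eq

rightIndex-cong : ∀ (r r′ : Vec Bool n) {c} → lookup r c ≡ lookup r′ c →
                  rightIndex r c ≡ rightIndex r′ c
rightIndex-cong _ _ {c} eq = cong (λ b → 2 * toℕ c + 1 ∸ bit b) eq

-- Slot r act p i T: under the reverse bits r and the active bits act, the
-- subtree hanging at index i below p is T.  A leaf is an index that is inactive
-- or out of range.
data Slot (r act : Vec Bool n) (p : Fin n) (i : ℕ) : Tree n → Set where
  leaf : (∀ j → toℕ j ≡ i → lookup act j ≡ false) → Slot r act p i leaf
  node : ∀ {L c R} → toℕ c ≡ i → p Fin.< c → lookup act c ≡ true →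
         c ∉ L → c ∉ R → Disjoint L R →
         Slot r act c (leftIndex r c) L → Slot r act c (rightIndex r c) R →
         Slot r act p i (node L c R)

Slot-at : ∀ {r act : Vec Bool n} {p i j T} → i ≡ j → Slot r act p i T → Slot r act p j T
Slot-at refl s = s

-- Reverse bits matter only at the nodes of `T`, but a leaf also speaks of an index outside `T`,
-- which must stay inactive; hence the third hypothesis.
Slot-frame : ∀ {r r′ act act′ : Vec Bool n} {p i T} →
             (∀ {j} → j ∈ T → lookup r j ≡ lookup r′ j) →
             (∀ {j} → j ∈ T → lookup act′ j ≡ lookup act j) →
             (∀ {j} → lookup act j ≡ false → lookup act′ j ≡ false) →
             Slot r act p i T → Slot r′ act′ p i T
Slot-frame bits same off (leaf inactive) = leaf (λ j eq → off (inactive j eq))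
Slot-frame {r = r} {r′} bits same off (node eq p<c on c∉L c∉R L#R sL sR) =
  node eq p<c (trans (same here) on) c∉L c∉R L#R
    (Slot-at (leftIndex-cong r r′ (bits here)) (Slot-frame (bits ∘ inLeft) (same ∘ inLeft) off sL))
    (Slot-at (rightIndex-cong r r′ (bits here)) (Slot-frame (bits ∘ inRight) (same ∘ inRight) off sR))

-- Pending merges of a heap and the effect of one join.

module Heap (O : StrictTotalOrder a ℓ₁ ℓ₂) (n : ℕ) where

  open StrictTotalOrder O using (_<?_) renaming (Carrier to V)
  open Merging O
  open State
  module C  = SetoidPermutation comparisonSetoid
  module Cₚ = SetoidPermutationₚ comparisonSetoid

  -- The element at the root v and the comparisons that determined it are not
  -- included, so neither function depends on v.
  rest : Vec V n → Tree n → List V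
  rest e leaf         = []
  rest e (node L c R) = mergeValues (rest e L) (lookup e c ∷ rest e R)

  pending : Vec V n → Tree n → List (Comparison O)
  pending e leaf         = []
  pending e (node L c R) =
    pending e L ++ pending e R ++ mergeComparisons (rest e L) (lookup e c ∷ rest e R)

  rest-cong : ∀ {e e′} T → (∀ {j} → j ∈ T → lookup e j ≡ lookup e′ j) → rest e T ≡ rest e′ T
  rest-cong leaf         same = refl
  rest-cong (node L c R) same =
    cong₂ mergeValues (rest-cong L (same ∘ inLeft))
      (cong₂ _∷_ (same here) (rest-cong R (same ∘ inRight)))

  pending-cong : ∀ {e e′} T → (∀ {j} → j ∈ T → lookup e j ≡ lookup e′ j) →
                 pending e T ≡ pending e′ T
  pending-cong leaf         same = refl
  pending-cong (node L c R) same =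
    cong₂ _++_ (pending-cong L (same ∘ inLeft))
      (cong₂ _++_ (pending-cong R (same ∘ inRight))
        (cong₂ mergeComparisons (rest-cong L (same ∘ inLeft))
          (cong₂ _∷_ (same here) (rest-cong R (same ∘ inRight)))))

  ∷↭++++∷ : ∀ {x} xs ys {zs} → x ∷ xs ++ ys ++ zs ↭ xs ++ ys ++ x ∷ zs
  ∷↭++++∷ xs ys = C.↭-sym (C.↭-trans (Cₚ.++⁺ˡ xs (Cₚ.↭-shift ys _)) (Cₚ.↭-shift xs _))

  merge⇒↭ : ∀ {xs ys} → Apart xs ys → mergeComparisons xs ys ↭ mergeComparisons ys xs
  merge⇒↭ {xs} {ys} d = C.↭-reflexive-≋ (proj₂ (merge-comm xs ys d))

  module _ (S : State O n) (v c : Fin n) where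

    join-elements : ∀ {j} → j ≢ v → j ≢ c →
                    lookup (elements (join O v c S)) j ≡ lookup (elements S) j
    join-elements j≢v j≢c with lookup (elements S) c <? lookup (elements S) v
    ... | no _  = refl
    ... | yes _ = trans (lookup∘update′ j≢c (elements S [ v ]≔ _) _)
                        (lookup∘update′ j≢v (elements S) _)

    join-reverseBits : ∀ {j} → j ≢ c →
                       lookup (reverseBits (join O v c S)) j ≡ lookup (reverseBits S) j
    join-reverseBits j≢c with lookup (elements S) c <? lookup (elements S) v
    ... | no _  = refl
    ... | yes _ = lookup∘updateAt′ _ c j≢c (reverseBits S)

  -- join O i j S is joinIf (does (sⱼ <? sᵢ)) i j S by computation.
  joinIf : Bool → Fin n → Fin n → State O n → State O n
  joinIf less i j S = record
    { elements    = if less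
                    then elements S [ i ]≔ lookup (elements S) j [ j ]≔ lookup (elements S) i
                    else elements S
    ; reverseBits = if less then reverseBits S [ j ]%= not else reverseBits S
    ; active      = active S
    ; output      = output S
    ; comparisons = comparisons S ∷ʳ (lookup (elements S) j , lookup (elements S) i)
    }

  record Joined (S : State O n) (v c p : Fin n) (i : ℕ) (L R : Tree n) (S′ : State O n) :
                Set (a ⊔ ℓ₁) where
    field
      tree   : Tree n
      slot   : Slot (reverseBits S′) (active S′) p i tree
      ⊆node  : ∀ {j} → j ∈ tree → j ∈ node L c R
      values : lookup (elements S′) v ∷ rest (elements S′) tree ≡
               mergeValues (lookup (elements S) v ∷ rest (elements S) L)
                           (lookup (elements S) c ∷ rest (elements S) R)
      future : (lookup (elements S) c , lookup (elements S) v) ∷ pending (elements S′) tree ↭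
               pending (elements S) L ++ pending (elements S) R ++
               mergeComparisons (lookup (elements S) v ∷ rest (elements S) L)
                                (lookup (elements S) c ∷ rest (elements S) R)

  -- If the element at `v` wins, the merge continues with `L` against (c; R), which is what
  -- `node L c R` encodes. If the element at `c` wins, the merge continues with (v; L) against `R`;
  -- the swap and the flip encode this as `node R c L`, with the two sides exchanged, so
  -- `merge-comm` closes the gap.
  join-heaps : ∀ (S : State O n) {v c p i L R} → v ≢ c → v ∉ L → v ∉ R →
               Slot (reverseBits S) (active S) p i (node L c R) →
               Apart (lookup (elements S) v ∷ rest (elements S) L)
                     (lookup (elements S) c ∷ rest (elements S) R) →
               Joined S v c p i L R (join O v c S)
  join-heaps S {v} {c} {p} {i} {L} {R} v≢c v∉L v∉R
    (node eq p<c on c∉L c∉R L#R sL sR) ((_ ∷ v≉R) ∷ L≉cR) = cases _ refl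
    where
    e  = elements S
    r  = reverseBits S
    r′ = r [ c ]%= not
    e′ = e [ v ]≔ lookup e c [ c ]≔ lookup e v

    vL#R : Apart (lookup e v ∷ rest e L) (rest e R)
    vL#R = v≉R ∷ All.map All.tail L≉cR

    bits : ∀ {T} → c ∉ T → ∀ {j} → j ∈ T → lookup r j ≡ lookup r′ j
    bits c∉T j∈T = sym (lookup∘updateAt′ _ c (∈∧∉⇒≢ j∈T c∉T) r)

    Slot-flip : ∀ {i T} → c ∉ T → Slot r (active S) c i T → Slot r′ (active S) c i T
    Slot-flip c∉T = Slot-frame (bits c∉T) (λ _ → refl) (λ off → off)

    e′c : lookup e′ c ≡ lookup e v
    e′c = lookup∘update c (e [ v ]≔ lookup e c) _

    e′v : lookup e′ v ≡ lookup e c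
    e′v = trans (lookup∘update′ v≢c (e [ v ]≔ lookup e c) _) (lookup∘update v e _)

    same : ∀ {T} → v ∉ T → c ∉ T → ∀ {j} → j ∈ T → lookup e′ j ≡ lookup e j
    same v∉T c∉T j∈T = trans (lookup∘update′ (∈∧∉⇒≢ j∈T c∉T) (e [ v ]≔ lookup e c) _)
                             (lookup∘update′ (∈∧∉⇒≢ j∈T v∉T) e _)

    restL = rest-cong L (same v∉L c∉L)
    restR = rest-cong R (same v∉R c∉R)

    mergeˡ = merge-∷ˡ (lookup e v) (rest e L) (lookup e c) (rest e R)
    mergeʳ = merge-∷ʳ (lookup e v) (rest e L) (lookup e c) (rest e R)

    cases : ∀ b → does (lookup e c <? lookup e v) ≡ b → Joined S v c p i L R (joinIf b v c S)
    cases false c≮v = record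
      { tree   = node L c R
      ; slot   = node eq p<c on c∉L c∉R L#R sL sR
      ; ⊆node  = λ j∈ → j∈
      ; values = sym (cong proj₁ (mergeˡ c≮v))
      ; future = C.↭-trans (∷↭++++∷ (pending e L) (pending e R))
          (C.↭-reflexive (cong (λ m → pending e L ++ pending e R ++ proj₂ m) (sym (mergeˡ c≮v))))
      }
    cases true c<v = record
      { tree   = node R c L
      ; slot   = node eq p<c on c∉R c∉L (λ j∈R j∈L → L#R j∈L j∈R)
          (Slot-at (sym (leftIndex-flip r c)) (Slot-flip c∉R sR))
          (Slot-at (sym (rightIndex-flip r c)) (Slot-flip c∉L sL))
      ; ⊆node  = λ { here → here ; (inLeft j∈) → inRight j∈ ; (inRight j∈) → inLeft j∈ }
      ; values = trans (cong₂ _∷_ e′v (trans (cong₂ mergeValues restR (cong₂ _∷_ e′c restL))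
                                             (sym (proj₁ (merge-comm _ _ vL#R)))))
                       (sym (cong proj₁ (mergeʳ c<v)))
      ; future = begin
          _ ∷ pending e′ R ++ pending e′ L ++ mergeComparisons (rest e′ R) (lookup e′ c ∷ rest e′ L)
            ≡⟨ cong (_ ∷_) (cong₂ _++_ (pending-cong R (same v∉R c∉R))
                 (cong₂ _++_ (pending-cong L (same v∉L c∉L))
                   (cong₂ mergeComparisons restR (cong₂ _∷_ e′c restL)))) ⟩
          _ ∷ pending e R ++ pending e L ++ mergeComparisons (rest e R) (lookup e v ∷ rest e L)
            ↭⟨ C.↭-prep _ (Cₚ.shifts (pending e R) (pending e L)) ⟩
          _ ∷ pending e L ++ pending e R ++ mergeComparisons (rest e R) (lookup e v ∷ rest e L)
            ↭⟨ ∷↭++++∷ (pending e L) (pending e R) ⟩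
          pending e L ++ pending e R ++ _ ∷ mergeComparisons (rest e R) (lookup e v ∷ rest e L)
            ↭⟨ Cₚ.++⁺ˡ (pending e L) (Cₚ.++⁺ˡ (pending e R) (C.↭-prep _ (merge⇒↭ vL#R))) ⟨
          pending e L ++ pending e R ++ _ ∷ mergeComparisons (lookup e v ∷ rest e L) (rest e R)
            ≡⟨ cong (λ m → pending e L ++ pending e R ++ proj₂ m) (mergeʳ c<v) ⟨
          pending e L ++ pending e R ++
          mergeComparisons (lookup e v ∷ rest e L) (lookup e c ∷ rest e R) ∎
      }
      where open C.PermutationReasoning

-- Filling a hole along the special path.

module Fill (O : StrictTotalOrder a ℓ₁ ℓ₂) (n : ℕ) where
  open Merging O
  open Heap O n
  open State

  child≡just : ∀ (S : State O n) {v c i} → toℕ c ≡ i → v Fin.< c → lookup (active S) c ≡ true →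
               ∃ λ v<c → child O S v i ≡ just (c , v<c)
  child≡just S {v} {c} refl v<c on with toℕ v ℕₚ.<? toℕ c | toℕ c ℕₚ.<? n
  ... | yes _   | yes c<n = at _ _ (Finₚ.fromℕ<-toℕ c c<n)
    where
    -- `child` returns `fromℕ< c<n`, equal to `c` only propositionally. Generalising it to `x`
    -- allows matching on the equation, and the inequality in the answer is whatever `child`
    -- produced.
    at : ∀ x (v<x : v Fin.< x) → x ≡ c →
         ∃ λ (v<c : v Fin.< c) →
           (if lookup (active S) x then just (x , v<x) else nothing) ≡
           just {A = ∃ (v Fin.<_)} (c , v<c)
    at x v<x refl = v<x , cong (λ b → if b then just (x , v<x) else nothing) on
  ... | yes _   | no c≮n  = contradiction (Finₚ.toℕ<n c) c≮n
  ... | no v≮c  | _       = contradiction v<c v≮c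

  child≡nothing : ∀ (S : State O n) {v i} → (∀ j → toℕ j ≡ i → lookup (active S) j ≡ false) →
                  child O S v i ≡ nothing
  child≡nothing S {v} {i} off with toℕ v ℕₚ.<? i | i ℕₚ.<? n
  ... | yes _ | yes i<n rewrite off (fromℕ< i<n) (Finₚ.toℕ-fromℕ< i<n) = refl
  ... | yes _ | no _  = refl
  ... | no _  | yes _ = refl
  ... | no _  | no _  = refl

  -- The hole `v` and the place (p, i) where `T` hangs are independent, so that the record serves
  -- every lower part of the special path of `v`. The first element of `rest` moves into the hole,
  -- and the other fields except `made`, `comparisons≡` and `future` describe what remains of `T`
  -- and what is left untouched.
  record Filled (S : State O n) (v p : Fin n) (i : ℕ) (T : Tree n) (S′ : State O n) :
                Set (a ⊔ ℓ₁) where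
    field
      tree         : Tree n
      slot         : Slot (reverseBits S′) (active S′) p i tree
      tree⊆        : ∀ {j} → j ∈ tree → j ∈ T
      elements≡    : ∀ {j} → j ≢ v → j ∉ T → lookup (elements S′) j ≡ lookup (elements S) j
      bits≡        : ∀ {j} → j ∉ T → lookup (reverseBits S′) j ≡ lookup (reverseBits S) j
      active≡      : ∀ {j} → j ∉ T → lookup (active S′) j ≡ lookup (active S) j
      inactive     : ∀ {j} → lookup (active S) j ≡ false → lookup (active S′) j ≡ false
      values       : lookup (elements S′) v ∷ rest (elements S′) tree ≡ rest (elements S) T
      made         : List (Comparison O)
      comparisons≡ : comparisons S′ ≡ comparisons S ++ made
      future       : made ++ pending (elements S′) tree ↭ pending (elements S) T

  -- What fillHoleAcc does once the left path from the right child c of v is known.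
  descend : ∀ (v c : Fin n) → (∀ (x : Fin n) → c Fin.≤ x → Acc Fin._>_ x) →
            List (Fin n) × ∃ (λ (x : Fin n) → c Fin.≤ x) → State O n → State O n
  descend v c accs (ys , x , c≤x) S =
    foldr (join O v) (fillHoleAcc O x (accs x c≤x) (moveElement O x v S)) ys

  fillHole-leaf : ∀ (S : State O n) {v} (α : Acc Fin._>_ v) → rightChild O S v ≡ nothing →
                  fillHoleAcc O v α S ≡ deactivate O v S
  fillHole-leaf S (acc _) none rewrite none = refl

  fillHole-descend : ∀ (S : State O n) {v c v<c} {rs : ∀ {x} → v Fin.< x → Acc Fin._>_ x} →
                     rightChild O S v ≡ just (c , v<c) →
                     fillHoleAcc O v (acc rs) S ≡
                     descend v c (λ x c≤x → rs (<-≤-trans v<c c≤x))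
                       (leftPath O S c (>-wellFounded c)) S
  fillHole-descend S some rewrite some = refl

  descend-leaf : ∀ (S : State O n) {v c} accs (α : Acc Fin._>_ c) → leftChild O S c ≡ nothing →
                 descend v c accs (leftPath O S c α) S ≡
                 fillHoleAcc O c (accs c ≤-refl) (moveElement O c v S)
  descend-leaf S accs (acc _) none rewrite none = refl

  descend-node : ∀ (S : State O n) {v c d c<d} accs {rs : ∀ {x} → c Fin.< x → Acc Fin._>_ x} →
                 leftChild O S c ≡ just (d , c<d) →
                 descend v c accs (leftPath O S c (acc rs)) S ≡
                 join O v c
                   (descend v d (λ x d≤x → accs x (≤-trans (<⇒≤ c<d) d≤x))
                     (leftPath O S d (rs c<d)) S)
  descend-node S accs some rewrite some = refl

  inactive-update : ∀ {act : Vec Bool n} c {j} → lookup act j ≡ false →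
                    lookup (act [ c ]≔ false) j ≡ false
  inactive-update {act} c {j} off with j Finₚ.≟ c
  ... | yes refl = lookup∘update c act false
  ... | no j≢c   = trans (lookup∘update′ j≢c act false) off

  -- The special path ends in a node without children: its element is the last one, and merging an
  -- empty list with it costs nothing.
  deactivate-fills : ∀ (S : State O n) {v c p} →
                     Filled S v p (toℕ c) (node leaf c leaf) (deactivate O c (moveElement O c v S))
  deactivate-fills S {v} {c} = record
    { tree         = leaf
    ; slot         = leaf λ j j≡c →
        trans (cong (lookup (active S [ c ]≔ false)) (Finₚ.toℕ-injective j≡c))
              (lookup∘update c (active S) false)
    ; tree⊆        = λ ()
    ; elements≡    = λ j≢v _ → lookup∘update′ j≢v (elements S) _
    ; bits≡        = λ _ → refl
    ; active≡      = λ j∉T → lookup∘update′ (λ { refl → j∉T here }) (active S) _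
    ; inactive     = inactive-update {active S} c
    ; values       = cong (_∷ []) (lookup∘update v (elements S) _)
    ; made         = []
    ; comparisons≡ = sym (++-identityʳ _)
    ; future       = C.↭-refl
    }

  -- The special path ends at `c`, so the left input of its merge is exhausted. The element at `c`
  -- comes next without a comparison, and the hole passes on to the heap (c; R).
  move-fills : ∀ (S : State O n) {v c p i R S₂} → v ∉ node leaf c R →
               Slot (reverseBits S) (active S) p i (node leaf c R) →
               Filled (moveElement O c v S) c c (rightIndex (reverseBits S) c) R S₂ →
               Filled S v p i (node leaf c R) S₂
  move-fills S {v} {c} {p} {i} {R} {S₂} v∉T (node eq p<c on _ c∉R _ (leaf noLeft) _) filled = record
    { tree         = node leaf c F.tree
    ; slot         = node eq p<c (trans (F.active≡ c∉R) on) (λ ()) (c∉R ∘ F.tree⊆) (λ ())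
        (leaf λ j j≡ → F.inactive (noLeft j (trans j≡ (leftIndex-cong r₂ (reverseBits S) (F.bits≡ c∉R)))))
        (Slot-at (sym (rightIndex-cong r₂ (reverseBits S) (F.bits≡ c∉R))) F.slot)
    ; tree⊆        = λ { here → here ; (inLeft ()) ; (inRight j∈) → inRight (F.tree⊆ j∈) }
    ; elements≡    = λ j≢v j∉T → trans (F.elements≡ (λ { refl → j∉T here }) (j∉T ∘ inRight))
                                       (lookup∘update′ j≢v (elements S) _)
    ; bits≡        = λ j∉T → F.bits≡ (j∉T ∘ inRight)
    ; active≡      = λ j∉T → F.active≡ (j∉T ∘ inRight)
    ; inactive     = F.inactive
    ; values       = cong₂ _∷_
        (trans (F.elements≡ v≢c (v∉T ∘ inRight)) (lookup∘update v (elements S) _))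
        (trans F.values (rest-cong R same))
    ; made         = F.made
    ; comparisons≡ = F.comparisons≡
    ; future       = begin
        F.made ++ pending e₂ F.tree ++ []  ≡⟨ cong (F.made ++_) (++-identityʳ _) ⟩
        F.made ++ pending e₂ F.tree        ↭⟨ F.future ⟩
        pending (elements S₁) R            ≡⟨ pending-cong R same ⟩
        pending (elements S) R             ≡⟨ ++-identityʳ _ ⟨
        pending (elements S) R ++ []       ∎
    }
    where
    open C.PermutationReasoning
    S₁ = moveElement O c v S
    e₂ = elements S₂
    r₂ = reverseBits S₂
    v≢c : v ≢ c
    v≢c refl = v∉T here
    same : ∀ {j} → j ∈ R → lookup (elements S₁) j ≡ lookup (elements S) j
    same j∈R = lookup∘update′ (∈∧∉⇒≢ j∈R (v∉T ∘ inRight)) (elements S) _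
    module F = Filled filled

  -- Once the path below `c` has refilled `v` from `L`, the heap at `v` lists exactly `rest` of `L`.
  -- The join at `c` is then the first comparison of the merge of that list with (c; R), which was
  -- pending.
  join-fills : ∀ (S : State O n) {v c p i L R S₂} → v ∉ node L c R →
               Slot (reverseBits S) (active S) p i (node L c R) →
               Apart (rest (elements S) L) (lookup (elements S) c ∷ rest (elements S) R) →
               Filled S v c (leftIndex (reverseBits S) c) L S₂ →
               Filled S v p i (node L c R) (join O v c S₂)
  join-fills S {v} {c} {p} {i} {L} {R} {S₂} v∉T (node eq p<c on c∉L c∉R L#R _ sR) apart filled = record
    { tree         = J.tree
    ; slot         = J.slot
    ; tree⊆        = λ j∈ → enlarge (J.⊆node j∈)
    ; elements≡    = λ j≢v j∉T → trans (join-elements S₂ v c j≢v (λ { refl → j∉T here }))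
                                       (F.elements≡ j≢v (j∉T ∘ inLeft))
    ; bits≡        = λ j∉T → trans (join-reverseBits S₂ v c (λ { refl → j∉T here }))
                               (F.bits≡ (j∉T ∘ inLeft))
    ; active≡      = λ j∉T → F.active≡ (j∉T ∘ inLeft)
    ; inactive     = F.inactive
    ; values       = trans J.values (cong₂ mergeValues F.values cR≡)
    ; made         = F.made ∷ʳ cv
    ; comparisons≡ = trans (cong (_∷ʳ cv) F.comparisons≡) (++-assoc (comparisons S) F.made _)
    ; future       = begin
        (F.made ∷ʳ cv) ++ pending e₃ J.tree
          ≡⟨ ++-assoc F.made _ _ ⟩
        F.made ++ cv ∷ pending e₃ J.tree
          ↭⟨ Cₚ.++⁺ˡ F.made J.future ⟩
        F.made ++ pending e₂ F.tree ++ pending e₂ R ++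
        mergeComparisons (lookup e₂ v ∷ rest e₂ F.tree) (lookup e₂ c ∷ rest e₂ R)
          ≡⟨ cong₂ (λ P Q → F.made ++ pending e₂ F.tree ++ P ++ Q)
               (pending-cong R same) (cong₂ mergeComparisons F.values cR≡) ⟩
        F.made ++ pending e₂ F.tree ++ pending e R ++
        mergeComparisons (rest e L) (lookup e c ∷ rest e R)
          ≡⟨ ++-assoc F.made _ _ ⟨
        (F.made ++ pending e₂ F.tree) ++ pending e R ++
        mergeComparisons (rest e L) (lookup e c ∷ rest e R)
          ↭⟨ Cₚ.++⁺ʳ _ F.future ⟩
        pending e (node L c R) ∎
    }
    where
    open C.PermutationReasoning
    e  = elements S
    e₂ = elements S₂
    e₃ = elements (join O v c S₂)
    cv = lookup e₂ c , lookup e₂ v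
    module F = Filled filled
    v≢c : v ≢ c
    v≢c refl = v∉T here
    R∌ : ∀ {j} → j ∈ R → j ∉ L
    R∌ j∈R j∈L = L#R j∈L j∈R
    same : ∀ {j} → j ∈ R → lookup e₂ j ≡ lookup e j
    same j∈R = F.elements≡ (∈∧∉⇒≢ j∈R (v∉T ∘ inRight)) (R∌ j∈R)
    cR≡ : lookup e₂ c ∷ rest e₂ R ≡ lookup e c ∷ rest e R
    cR≡ = cong₂ _∷_ (F.elements≡ (≢-sym v≢c) c∉L) (rest-cong R same)
    slot₂ : Slot (reverseBits S₂) (active S₂) p i (node F.tree c R)
    slot₂ = node eq p<c (trans (F.active≡ c∉L) on) (c∉L ∘ F.tree⊆) c∉R (λ j∈ → L#R (F.tree⊆ j∈))
      (Slot-at (sym (leftIndex-cong (reverseBits S₂) (reverseBits S) (F.bits≡ c∉L))) F.slot)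
      (Slot-at (sym (rightIndex-cong (reverseBits S₂) (reverseBits S) (F.bits≡ c∉L)))
        (Slot-frame (λ j∈R → sym (F.bits≡ (R∌ j∈R))) (λ j∈R → F.active≡ (R∌ j∈R)) F.inactive sR))
    module J = Joined (join-heaps S₂ v≢c (v∉T ∘ inLeft ∘ F.tree⊆) (v∉T ∘ inRight) slot₂
      (subst₂ Apart (sym F.values) (sym cR≡) apart))
    enlarge : ∀ {j} → j ∈ node F.tree c R → j ∈ node L c R
    enlarge here         = here
    enlarge (inLeft j∈)  = inLeft (F.tree⊆ j∈)
    enlarge (inRight j∈) = inRight j∈

  -- A leaf is excluded because then no element moves into the hole: `v` itself is deactivated.
  fillHole-node : ∀ (S : State O n) {v} (α : Acc Fin._>_ v) T → T ≢ leaf →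
                  v ∉ T → Slot (reverseBits S) (active S) v (rightIndex (reverseBits S) v) T →
                  Distinct (rest (elements S) T) →
                  Filled S v v (rightIndex (reverseBits S) v) T (fillHoleAcc O v α S)

  -- The induction is on the tree, along the special path. A node `c` with a left child lies
  -- strictly inside the path and is joined after the recursion; otherwise `c` is the end of the
  -- path, which is deactivated or becomes the next hole.
  descend-fills : ∀ (S : State O n) {v p i} {c : Fin n} L R
                  (accs : ∀ (x : Fin n) → c Fin.≤ x → Acc Fin._>_ x) (α : Acc Fin._>_ c) →
                  v ∉ node L c R → Slot (reverseBits S) (active S) p i (node L c R) →
                  Distinct (rest (elements S) (node L c R)) →
                  Filled S v p i (node L c R) (descend v c accs (leftPath O S c α) S)

  fillHole-node S α        leaf         T≢leaf _   _ _ = contradiction refl T≢leaf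
  fillHole-node S (acc rs) (node L c R) _      v∉T s@(node eq v<c on _ _ _ _ _) distinct =
    subst (Filled S _ _ _ _) (sym (fillHole-descend S (proj₂ right)))
      (descend-fills S L R (λ x c≤x → rs (<-≤-trans (proj₁ right) c≤x)) (>-wellFounded c)
        v∉T s distinct)
    where right = child≡just S eq v<c on

  descend-fills S leaf leaf accs α v∉T (node refl p<c on _ _ _ (leaf noLeft) (leaf noRight)) _ =
    subst (Filled S _ _ _ _)
      (sym (trans (descend-leaf S accs α (child≡nothing S noLeft))
                  (fillHole-leaf _ (accs _ ≤-refl) (child≡nothing _ noRight))))
      (deactivate-fills S)
  descend-fills S {v} {c = c} leaf R@(node _ _ _) accs α v∉T
    s@(node _ _ _ _ c∉R _ (leaf noLeft) sR) (_ ∷ distinctR) =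
    subst (Filled S _ _ _ _) (sym (descend-leaf S accs α (child≡nothing S noLeft)))
      (move-fills S v∉T s
        (fillHole-node (moveElement O c v S) (accs _ ≤-refl) R (λ ()) c∉R sR
          (subst Distinct (sym (rest-cong R (λ j∈R →
              lookup∘update′ (∈∧∉⇒≢ j∈R (v∉T ∘ inRight)) (elements S) _)))
            distinctR)))
  descend-fills S L@(node L₁ _ L₂) R accs (acc rs) v∉T
    s@(node _ _ _ _ _ _ sL@(node d≡ c<d on _ _ _ _ _) _) distinct =
    subst (Filled S _ _ _ _) (sym (descend-node S accs (proj₂ left)))
      (join-fills S v∉T s (proj₂ (proj₂ parts))
        (descend-fills S L₁ L₂ (λ x d≤x → accs x (≤-trans (<⇒≤ (proj₁ left)) d≤x)) (rs (proj₁ left))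
          (v∉T ∘ inLeft) sL (proj₁ parts)))
    where
    left  = child≡just S d≡ c<d on
    parts = Distinct-merge⁻ (rest (elements S) L) (_ ∷ rest (elements S) R) distinct

-- Construction as a schedule of joins.

-- A stage of the construction: heaps built so far, combined by the joins still to
-- be performed; todo E c F stands for the join of c with the root of E.
data Schedule (n : ℕ) : Set where
  built : Fin n → Tree n → Schedule n
  todo  : Schedule n → Fin n → Schedule n → Schedule n

root : Schedule n → Fin n
root (built v T)  = v
root (todo E c F) = root E

data _∈ˢ_ {n} (j : Fin n) : Schedule n → Set where
  atRoot  : ∀ {T} → j ∈ˢ built j T
  inTree  : ∀ {v T} → j ∈ T → j ∈ˢ built v T
  inLeft  : ∀ {E c F} → j ∈ˢ E → j ∈ˢ todo E c F
  inRight : ∀ {E c F} → j ∈ˢ F → j ∈ˢ todo E c F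

data _∈ᵗ_ {n} (j : Fin n) : Schedule n → Set where
  here    : ∀ {E F} → j ∈ᵗ todo E j F
  inLeft  : ∀ {E c F} → j ∈ᵗ E → j ∈ᵗ todo E c F
  inRight : ∀ {E c F} → j ∈ᵗ F → j ∈ᵗ todo E c F

Disjointˢ : Schedule n → Schedule n → Set
Disjointˢ E F = ∀ {j} → j ∈ˢ E → ¬ j ∈ˢ F

root∈ : (E : Schedule n) → root E ∈ˢ E
root∈ (built v T)  = atRoot
root∈ (todo E c F) = inLeft (root∈ E)

noFlips : Vec Bool n
noFlips = replicate _ false

-- The reverse bit of a node is flipped by its own join only, hence the fixed
-- indices 2c and 2c + 1 below a todo node c.
data Valid (r act : Vec Bool n) (p : Fin n) (i : ℕ) : Schedule n → Set where
  built : ∀ {v T} → v ∉ T → Slot r act p i T → Valid r act p i (built v T)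
  todo  : ∀ {E c F} → toℕ c ≡ i → p Fin.< c → lookup act c ≡ true →
          root F ≡ c → dAncestor noFlips c ≡ root E → Disjointˢ E F →
          Valid r act c (2 * toℕ c) E → Valid r act c (suc (2 * toℕ c)) F →
          Valid r act p i (todo E c F)

Valid-frame : ∀ {r r′ act : Vec Bool n} {p i E} → (∀ {j} → j ∈ˢ E → lookup r j ≡ lookup r′ j) →
              Valid r act p i E → Valid r′ act p i E
Valid-frame bits (built v∉T s) = built v∉T (Slot-frame (bits ∘ inTree) (λ _ → refl) (λ off → off) s)
Valid-frame bits (todo c≡ p<c on root≡ anc≡ E#F vE vF) =
  todo c≡ p<c on root≡ anc≡ E#F (Valid-frame (bits ∘ inLeft) vE) (Valid-frame (bits ∘ inRight) vF)

-- Indices grow on the way down, so the largest node still to be joined has no outstanding join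
-- below it.
todo> : ∀ {r act : Vec Bool n} {p i E j} → Valid r act p i E → j ∈ᵗ E → p Fin.< j
todo> (todo _ p<c _ _ _ _ _ _)  here         = p<c
todo> (todo _ p<c _ _ _ _ vE _) (inLeft j∈)  = <-trans p<c (todo> vE j∈)
todo> (todo _ p<c _ _ _ _ _ vF) (inRight j∈) = <-trans p<c (todo> vF j∈)

todo⇒∈ : ∀ {r act : Vec Bool n} {p i E j} → Valid r act p i E → j ∈ᵗ E → j ∈ˢ E
todo⇒∈ {E = todo E c F} (todo _ _ _ root≡ _ _ _ _) here = inRight (subst (_∈ˢ F) root≡ (root∈ F))
todo⇒∈ (todo _ _ _ _ _ _ vE _) (inLeft j∈)  = inLeft (todo⇒∈ vE j∈)
todo⇒∈ (todo _ _ _ _ _ _ _ vF) (inRight j∈) = inRight (todo⇒∈ vF j∈)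

module Construction (O : StrictTotalOrder a ℓ₁ ℓ₂) (n : ℕ) where
  open StrictTotalOrder O using () renaming (Carrier to V)
  open Merging O
  open Heap O n
  open State

  values : Vec V n → Schedule n → List V
  values e (built v T)  = lookup e v ∷ rest e T
  values e (todo E c F) = mergeValues (values e E) (values e F)

  future : Vec V n → Schedule n → List (Comparison O)
  future e (built v T)  = pending e T
  future e (todo E c F) = future e E ++ future e F ++ mergeComparisons (values e E) (values e F)

  values-cong : ∀ {e e′} E → (∀ {j} → j ∈ˢ E → lookup e j ≡ lookup e′ j) →
                values e E ≡ values e′ E
  values-cong (built v T)  same = cong₂ _∷_ (same atRoot) (rest-cong T (same ∘ inTree))
  values-cong (todo E c F) same =
    cong₂ mergeValues (values-cong E (same ∘ inLeft)) (values-cong F (same ∘ inRight))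

  future-cong : ∀ {e e′} E → (∀ {j} → j ∈ˢ E → lookup e j ≡ lookup e′ j) →
                future e E ≡ future e′ E
  future-cong (built v T)  same = pending-cong T (same ∘ inTree)
  future-cong (todo E c F) same =
    cong₂ _++_ (future-cong E (same ∘ inLeft))
      (cong₂ _++_ (future-cong F (same ∘ inRight))
        (cong₂ mergeComparisons (values-cong E (same ∘ inLeft)) (values-cong F (same ∘ inRight))))

  record Joins (S : State O n) (v j p : Fin n) (i : ℕ) (E : Schedule n) (S′ : State O n) :
               Set (a ⊔ ℓ₁) where
    field
      schedule  : Schedule n
      valid     : Valid (reverseBits S′) (active S′) p i schedule
      root≡     : root schedule ≡ root E
      ancestor∈ : v ∈ˢ E
      node∈     : j ∈ˢ E
      schedule⊆ : ∀ {x} → x ∈ˢ schedule → x ∈ˢ E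
      values≡   : values (elements S′) schedule ≡ values (elements S) E
      future↭   : (lookup (elements S) j , lookup (elements S) v) ∷ future (elements S′) schedule ↭
                  future (elements S) E
      todo⊆     : ∀ {x} → x ∈ᵗ schedule → x ∈ᵗ E × x ≢ j
      todo⊇     : ∀ {x} → x ∈ᵗ E → x ≢ j → x ∈ᵗ schedule

  module _ (S : State O n) (j : Fin n) (unflipped : lookup (reverseBits S) j ≡ false) where

    private
      v  = dAncestor noFlips j
      S′ = join O v j S
      e  = elements S
      e′ = elements S′

    join-here : ∀ {p i L R} → Valid (reverseBits S) (active S) p i (todo (built v L) j (built j R)) →
                Distinct (values e (todo (built v L) j (built j R))) →
                Joins S v j p i (todo (built v L) j (built j R)) S′
    join-here {p} {i} {L} {R}
      (todo j≡ p<j on refl anc≡ L#R (built v∉L sL) (built j∉R sR)) distinct = record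
      { schedule  = built v J.tree
      ; valid     = built (v∉T ∘ J.⊆node) J.slot
      ; root≡     = refl
      ; ancestor∈ = inLeft atRoot
      ; node∈     = inRight atRoot
      ; schedule⊆ = λ { atRoot → inLeft atRoot ; (inTree x∈) → widen (J.⊆node x∈) }
      ; values≡   = J.values
      ; future↭   = J.future
      ; todo⊆     = λ ()
      ; todo⊇     = λ { here x≢j → contradiction refl x≢j ; (inLeft ()) ; (inRight ()) }
      }
      where
      v≢j : v ≢ j
      v≢j v≡j = L#R atRoot (subst (_∈ˢ built j R) (sym v≡j) atRoot)
      v∉R : v ∉ R
      v∉R v∈R = L#R atRoot (inTree v∈R)
      v∉T : v ∉ node L j R
      v∉T = ∉node v≢j v∉L v∉R
      widen : ∀ {x} → x ∈ node L j R → x ∈ˢ todo (built v L) j (built j R)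
      widen here         = inRight atRoot
      widen (inLeft x∈)  = inLeft (inTree x∈)
      widen (inRight x∈) = inRight (inTree x∈)
      slot : Slot (reverseBits S) (active S) p i (node L j R)
      slot = node j≡ p<j on
        (λ j∈L → L#R (inTree j∈L) atRoot) j∉R (λ x∈L x∈R → L#R (inTree x∈L) (inTree x∈R))
        -- As the bit of `j` is unset, its child indices are the fixed 2j and 2j + 1 of `Valid`.
        (Slot-at (trans (sym (+-identityʳ _)) (cong (λ b → 2 * toℕ j + bit b) (sym unflipped))) sL)
        (Slot-at (trans (ℕₚ.+-comm 1 _) (cong (λ b → 2 * toℕ j + 1 ∸ bit b) (sym unflipped))) sR)
      module J = Joined
        (join-heaps S v≢j v∉L v∉R slot (proj₂ (proj₂ (Distinct-merge⁻ _ _ distinct))))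

    module _ {p : Fin n} {i : ℕ} {E : Schedule n} {c : Fin n} {F : Schedule n} where

      -- Both nodes touched by the join, `v` and `j`, lie in `E`, so disjointness leaves `F`
      -- unchanged.
      join-inLeft : Valid (reverseBits S) (active S) p i (todo E c F) → j ≢ c →
                    Joins S v j c (2 * toℕ c) E S′ → Joins S v j p i (todo E c F) S′
      join-inLeft (todo c≡ p<c on root≡ anc≡ E#F vE vF) j≢c J = record
        { schedule  = todo J.schedule c F
        ; valid     = todo c≡ p<c on root≡ (trans anc≡ (sym J.root≡)) (λ x∈ → E#F (J.schedule⊆ x∈))
                        J.valid (Valid-frame (λ x∈F → sym (join-reverseBits S v j (x≢ J.node∈ x∈F))) vF)
        ; root≡     = J.root≡
        ; ancestor∈ = inLeft J.ancestor∈
        ; node∈     = inLeft J.node∈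
        ; schedule⊆ = λ { (inLeft x∈) → inLeft (J.schedule⊆ x∈) ; (inRight x∈) → inRight x∈ }
        ; values≡   = cong₂ mergeValues J.values≡ (values-cong F same)
        ; future↭   = C.↭-trans
            (C.↭-reflexive (cong₂ (λ Q R → (_ ∷ future e′ J.schedule) ++ Q ++ R) (future-cong F same)
               (cong₂ mergeComparisons J.values≡ (values-cong F same))))
            (Cₚ.++⁺ʳ _ J.future↭)
        ; todo⊆     = λ { here         → here , ≢-sym j≢c
                        ; (inLeft x∈)  → inLeft (proj₁ (J.todo⊆ x∈)) , proj₂ (J.todo⊆ x∈)
                        ; (inRight x∈) → inRight x∈ , x≢ J.node∈ (todo⇒∈ vF x∈) }
        ; todo⊇     = λ { here _           → here
                        ; (inLeft x∈) x≢j  → inLeft (J.todo⊇ x∈ x≢j)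
                        ; (inRight x∈) x≢j → inRight x∈ }
        }
        where
        module J = Joins J
        x≢ : ∀ {x y} → y ∈ˢ E → x ∈ˢ F → x ≢ y
        x≢ y∈E x∈F refl = E#F y∈E x∈F
        same : ∀ {x} → x ∈ˢ F → lookup e′ x ≡ lookup e x
        same x∈F = join-elements S v j (x≢ J.ancestor∈ x∈F) (x≢ J.node∈ x∈F)

      join-inRight : Valid (reverseBits S) (active S) p i (todo E c F) → j ≢ c →
                     Joins S v j c (suc (2 * toℕ c)) F S′ → Joins S v j p i (todo E c F) S′
      join-inRight (todo c≡ p<c on root≡ anc≡ E#F vE vF) j≢c J = record
        { schedule  = todo E c J.schedule
        ; valid     = todo c≡ p<c on (trans J.root≡ root≡) anc≡ (λ x∈E x∈ → E#F x∈E (J.schedule⊆ x∈))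
                        (Valid-frame (λ x∈E → sym (join-reverseBits S v j (x≢ x∈E J.node∈))) vE) J.valid
        ; root≡     = refl
        ; ancestor∈ = inRight J.ancestor∈
        ; node∈     = inRight J.node∈
        ; schedule⊆ = λ { (inLeft x∈) → inLeft x∈ ; (inRight x∈) → inRight (J.schedule⊆ x∈) }
        ; values≡   = cong₂ mergeValues (values-cong E same) J.values≡
        ; future↭   = C.↭-trans
            (C.↭-reflexive (cong₂ (λ P R → _ ∷ P ++ future e′ J.schedule ++ R) (future-cong E same)
               (cong₂ mergeComparisons (values-cong E same) J.values≡)))
            (C.↭-trans (C.↭-sym (Cₚ.↭-shift (future e E) _))
              (Cₚ.++⁺ˡ (future e E) (Cₚ.++⁺ʳ _ J.future↭)))
        ; todo⊆     = λ { here         → here , ≢-sym j≢c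
                        ; (inLeft x∈)  → inLeft x∈ , x≢ (todo⇒∈ vE x∈) J.node∈
                        ; (inRight x∈) → inRight (proj₁ (J.todo⊆ x∈)) , proj₂ (J.todo⊆ x∈) }
        ; todo⊇     = λ { here _           → here
                        ; (inLeft x∈) x≢j  → inLeft x∈
                        ; (inRight x∈) x≢j → inRight (J.todo⊇ x∈ x≢j) }
        }
        where
        module J = Joins J
        x≢ : ∀ {x y} → x ∈ˢ E → y ∈ˢ F → x ≢ y
        x≢ x∈E y∈F refl = E#F x∈E y∈F
        same : ∀ {x} → x ∈ˢ E → lookup e′ x ≡ lookup e x
        same x∈E = join-elements S v j (x≢ x∈E J.ancestor∈) (x≢ x∈E J.node∈)

    join-step : ∀ {p i E} → Valid (reverseBits S) (active S) p i E → Distinct (values e E) →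
                (∀ {x} → x ∈ᵗ E → x Fin.≤ j) → j ∈ᵗ E → Joins S v j p i E S′
    join-step valid@(todo {built _ _} {F = built _ _} _ _ _ refl refl _ _ _) distinct _ here =
      join-here valid distinct
    join-step (todo {todo _ _ _} _ _ _ _ _ _ vE _) _ ≤j here =
      contradiction (≤j (inLeft here)) (ℕₚ.<⇒≱ (todo> vE here))
    join-step (todo {F = todo _ _ _} _ _ _ _ _ _ _ vF) _ ≤j here =
      contradiction (≤j (inRight here)) (ℕₚ.<⇒≱ (todo> vF here))
    join-step {E = todo E _ F} valid@(todo _ _ _ _ _ _ vE _) distinct ≤j (inLeft j∈) =
      join-inLeft valid (λ j≡c → ℕₚ.<⇒≢ (todo> vE j∈) (cong toℕ (sym j≡c)))
        (join-step vE (proj₁ (Distinct-merge⁻ _ (values e F) distinct)) (≤j ∘ inLeft) j∈)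
    join-step {E = todo E _ F} valid@(todo _ _ _ _ _ _ _ vF) distinct ≤j (inRight j∈) =
      join-inRight valid (λ j≡c → ℕₚ.<⇒≢ (todo> vF j∈) (cong toℕ (sym j≡c)))
        (join-step vF (proj₁ (proj₂ (Distinct-merge⁻ (values e E) _ distinct))) (≤j ∘ inRight) j∈)

-- The runs of construction and extraction.

-- Only bits of proper ancestors are read, and their indices are smaller. Construction goes through
-- the indices downwards, so these bits are still unset at the join of `j`.
dAncestorAcc-cong : ∀ (r r′ : Vec Bool n) j α α′ → (∀ {x} → x Fin.≤ j → lookup r x ≡ lookup r′ x) →
                    dAncestorAcc r j α ≡ dAncestorAcc r′ j α′
dAncestorAcc-cong r r′ zero    _        _         _    = refl
dAncestorAcc-cong r r′ (suc i) (acc rs) (acc rs′) same =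
  cong₂ (λ k d → if toℕ (suc i) ≡ᵇ k then parent (suc i) else d)
    (rightIndex-cong r r′ (same (<⇒≤ (parent-< i))))
    (dAncestorAcc-cong r r′ _ (rs (parent-< i)) (rs′ (parent-< i))
      (λ x≤ → same (≤-trans x≤ (<⇒≤ (parent-< i)))))

module Sorting (O : StrictTotalOrder a ℓ₁ ℓ₂) (n : ℕ) where
  open StrictTotalOrder O using () renaming (Carrier to V)
  open Merging O
  open Heap O (suc n)
  open Fill O (suc n)
  open Construction O (suc n)
  open State

  module _ (vs : List V) (cs : List (Comparison O)) where

    -- The joins at all nodes from m on have been performed; vs and cs are the
    -- output and the comparisons of mergesort.
    record Underway (m : ℕ) (S : State O (suc n)) : Set (a ⊔ ℓ₁) where
      field
        schedule   : Schedule (suc n)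
        valid      : Valid (reverseBits S) (active S) zero 1 schedule
        root≡      : root schedule ≡ zero
        values≡    : values (elements S) schedule ≡ vs
        future↭    : comparisons S ++ future (elements S) schedule ↭ cs
        todo<      : ∀ {x} → x ∈ᵗ schedule → toℕ x < m
        todo≥      : ∀ {x} → x ≢ zero → toℕ x < m → x ∈ᵗ schedule
        unflipped  : ∀ {x} → toℕ x < m → lookup (reverseBits S) x ≡ false
        rootActive : lookup (active S) zero ≡ true

    rebound : ∀ {k l S} → k ≡ l → Underway k S → Underway l S
    rebound refl U = U

    joinAt : Fin (suc n) → State O (suc n) → State O (suc n)
    joinAt j S = join O (dAncestor (reverseBits S) j) j S

    module _ (distinct : Distinct vs) where

      joinAt-underway : ∀ {S} j → j ≢ zero → Underway (suc (toℕ j)) S → Underway (toℕ j) (joinAt j S)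
      joinAt-underway {S} j j≢0 U = subst (λ v → Underway (toℕ j) (join O v j S)) (sym anc≡) (record
        { schedule   = J.schedule
        ; valid      = J.valid
        ; root≡      = trans J.root≡ root≡
        ; values≡    = trans J.values≡ values≡
        ; future↭    = C.↭-trans (C.↭-reflexive (++-assoc (comparisons S) _ _))
                         (C.↭-trans (Cₚ.++⁺ˡ (comparisons S) J.future↭) future↭)
        ; todo<      = λ x∈ → ℕₚ.≤∧≢⇒< (s≤s⁻¹ (todo< (proj₁ (J.todo⊆ x∈))))
                                        (proj₂ (J.todo⊆ x∈) ∘ Finₚ.toℕ-injective)
        ; todo≥      = λ x≢0 x<j → J.todo⊇ (todo≥ x≢0 (ℕₚ.m<n⇒m<1+n x<j))
                                           (λ { refl → ℕₚ.<-irrefl refl x<j })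
        ; unflipped  = λ x<j → trans (join-reverseBits S v j (λ { refl → ℕₚ.<-irrefl refl x<j }))
                                     (unflipped (ℕₚ.m<n⇒m<1+n x<j))
        ; rootActive = rootActive
        })
        where
        open Underway U
        v = dAncestor noFlips j
        anc≡ : dAncestor (reverseBits S) j ≡ v
        anc≡ = dAncestorAcc-cong (reverseBits S) noFlips j _ _
                 (λ {x} x≤j → trans (unflipped (s≤s x≤j)) (sym (lookup-replicate x false)))
        module J = Joins (join-step S j (unflipped ≤-refl) valid (subst Distinct (sym values≡) distinct)
                           (s≤s⁻¹ ∘ todo<) (todo≥ j≢0 ≤-refl))

      -- The right fold treats the tail, and so the larger indices, first; the offset `b` makes the
      -- statement apply to the tails of the tabulated list.
      joins-underway : ∀ {S} m (f : Fin m → Fin (suc n)) b → (∀ i → toℕ (f i) ≡ suc b + toℕ i) →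
                       Underway (suc b + m) S → Underway (suc b) (foldr joinAt S (List.tabulate f))
      joins-underway zero    f b f≡ U = rebound (+-identityʳ _) U
      joins-underway (suc m) f b f≡ U =
        rebound f0≡
          (joinAt-underway (f zero) (λ f0≡0 → ℕₚ.1+n≢0 (trans (sym f0≡) (cong toℕ f0≡0)))
            (rebound (cong suc (sym f0≡))
              (joins-underway m (f ∘ suc) (suc b)
                (λ i → trans (f≡ (suc i)) (ℕₚ.+-suc (suc b) (toℕ i)))
                (rebound (ℕₚ.+-suc (suc b) m) U))))
        where
        f0≡ : toℕ (f zero) ≡ suc b
        f0≡ = trans (f≡ zero) (+-identityʳ _)

      construct-underway : ∀ {S} → Underway (suc n) S → Underway 1 (construct O S)
      construct-underway = joins-underway n suc 0 (λ _ → refl)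

  extractAll-inactive : ∀ fuel (S : State O (suc n)) → lookup (active S) zero ≡ false →
                        extractAll O fuel S ≡ S
  extractAll-inactive zero       S off = refl
  extractAll-inactive (suc fuel) S off rewrite off = refl

  -- Each round with a nonempty tree removes the head of `rest`, so its length bounds the rounds
  -- left, while the comparisons made and pending together stay the same.
  extractAll-comparisons : ∀ fuel (S : State O (suc n)) T → zero ∉ T →
    Slot (reverseBits S) (active S) zero (rightIndex (reverseBits S) zero) T →
    lookup (active S) zero ≡ true → Distinct (rest (elements S) T) →
    length (rest (elements S) T) < fuel →
    comparisons (extractAll O fuel S) ↭ comparisons S ++ pending (elements S) T
  -- In the last round the root is switched off, and any remaining fuel is idle.
  extractAll-comparisons (suc fuel) S leaf 0∉T (leaf noRight) on distinct l< rewrite on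
    | fillHole-leaf (outputRoot O S) (>-wellFounded zero) (child≡nothing (outputRoot O S) noRight)
    | extractAll-inactive fuel (deactivate O zero (outputRoot O S)) (lookup∘update zero (active S) false) =
    C.↭-sym (Cₚ.++-identityʳ _)
  extractAll-comparisons (suc fuel) S T@(node _ _ _) 0∉T slot on distinct l< rewrite on =
    C.↭-trans
      (extractAll-comparisons fuel S₁ F.tree (0∉T ∘ F.tree⊆)
        (Slot-at (sym (rightIndex-cong (reverseBits S₁) (reverseBits S) (F.bits≡ 0∉T))) F.slot)
        (trans (F.active≡ 0∉T) on)
        (AllPairs.tail (subst Distinct (sym F.values) distinct))
        (subst (_≤ fuel) (sym (cong length F.values)) (s≤s⁻¹ l<)))
      (C.↭-trans (C.↭-reflexive (trans (cong (_++ pending (elements S₁) F.tree) F.comparisons≡)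
                                       (++-assoc (comparisons S) F.made _)))
        (Cₚ.++⁺ˡ (comparisons S) F.future))
    where
    S₀ = outputRoot O S
    S₁ = fillHole O zero S₀
    module F = Filled (fillHole-node S₀ (>-wellFounded zero) T (λ ()) 0∉T slot distinct)

  sort-comparisons : ∀ vs cs → Distinct vs → length vs ≡ suc n →
    ∀ s → Underway vs cs (suc n) (initial O s) → SameComparisons O (weakHeapsortComparisons O s) cs
  sort-comparisons vs cs distinct l≡ s U = finish (construct-underway vs cs distinct U)
    where
    S = construct O (initial O s)
    finish : Underway vs cs 1 S → comparisons (extractAll O (suc n) S) ↭ cs
    -- A node still to be joined would be below 1 by the bound and above the root index 0 by
    -- validity.
    finish record { schedule = todo _ _ _ ; valid = valid ; todo< = todo< } =
      contradiction (todo< here) (ℕₚ.≤⇒≯ (todo> valid here))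
    finish record { schedule = built _ T ; valid = built 0∉T slot ; root≡ = refl ; values≡ = refl
                  ; future↭ = future↭ ; unflipped = unflipped ; rootActive = on } =
      C.↭-trans
        (extractAll-comparisons (suc n) S T 0∉T
          -- The bit of the root is still unset, so its right child has index 1.
          (Slot-at (cong (λ b → 1 ∸ bit b) (sym (unflipped ≤-refl))) slot)
          on (AllPairs.tail distinct) (ℕₚ.≤-reflexive l≡))
        future↭

-- Finite injections, and lists cut into halves.

-- Pigeonhole: if `y` were missed, punching it out of the codomain would leave an injection into a
-- set too small for it.
injective⇒preimage : ∀ {f : Fin m → Fin n} → n ≤ m → Injective _≡_ _≡_ f → ∀ y → ∃ λ x → f x ≡ y
injective⇒preimage {n = suc n} {f} n<m f-inj y with Finₚ.any? (λ x → f x Finₚ.≟ y)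
... | yes x = x
... | no ∄x = contradiction n<m
  (ℕₚ.≤⇒≯ (Finₚ.injective⇒≤ {f = λ x → punchOut (y≢ x)}
    (λ {x} {z} eq → f-inj (Finₚ.punchOut-injective (y≢ x) (y≢ z) eq))))
  where
  y≢ : ∀ x → y ≢ f x
  y≢ x y≡fx = ∄x (x , sym y≡fx)

injective⇒permutation : ∀ {f : Fin n → Fin n} → Injective _≡_ _≡_ f → Permutation′ n
injective⇒permutation {f = f} f-inj =
  permutation f (proj₁ ∘ preimage) (proj₂ ∘ preimage) (λ x → f-inj (proj₂ (preimage (f x))))
  where preimage = injective⇒preimage ≤-refl f-inj

take-length-++ : ∀ (xs : List A) ys → take (length xs) (xs ++ ys) ≡ xs
take-length-++ []       ys = refl
take-length-++ (x ∷ xs) ys = cong (x ∷_) (take-length-++ xs ys)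

drop-length-++ : ∀ (xs : List A) ys → drop (length xs) (xs ++ ys) ≡ ys
drop-length-++ []       ys = refl
drop-length-++ (x ∷ xs) ys = drop-length-++ xs ys

tabulate-+ : ∀ m {n} (f : Fin (m + n) → A) →
             List.tabulate f ≡ List.tabulate (f ∘ (_↑ˡ n)) ++ List.tabulate (f ∘ (m ↑ʳ_))
tabulate-+ zero    f = refl
tabulate-+ (suc m) f = cong (f zero ∷_) (tabulate-+ m (f ∘ suc))

tabulate-combine : ∀ m (f : Fin (2 * m) → A) →
                   List.tabulate f ≡
                   List.tabulate (f ∘ combine {2} {m} zero) ++
                   List.tabulate (f ∘ combine {2} {m} (suc zero))
tabulate-combine m f =
  trans (tabulate-+ m f)
    (cong (List.tabulate (f ∘ (_↑ˡ (m + 0))) ++_)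
      -- `2 * m` unfolds to `m + (m + 0)`, and the summand 0 contributes the empty list.
      (trans (tabulate-+ m (f ∘ (m ↑ʳ_))) (++-identityʳ _)))

-- Distinguished ancestors in the initial heap.

-- Ancestor g i v: in a heap without flipped bits, v is the distinguished
-- ancestor of the index i, which lies on level g.
data Ancestor : ℕ → ℕ → ℕ → Set where
  top  : Ancestor 0 1 0
  even : ∀ {g i v} → Ancestor g i v → Ancestor (suc g) (2 * i) v
  odd  : ∀ {g i v} → Ancestor g i v → Ancestor (suc g) (suc (2 * i)) i

2^g≤ : ∀ {g i v} → Ancestor g i v → 2 ^ g ≤ i
2^g≤ top      = ≤-refl
2^g≤ (even p) = ℕₚ.*-monoʳ-≤ 2 (2^g≤ p)
2^g≤ (odd p)  = ℕₚ.m≤n⇒m≤1+n (ℕₚ.*-monoʳ-≤ 2 (2^g≤ p))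

<2^1+g : ∀ {g i v} → Ancestor g i v → i < 2 ^ suc g
<2^1+g top      = ≤-refl
<2^1+g (even p) = ℕₚ.*-monoʳ-< 2 (<2^1+g p)
<2^1+g (odd {g} {i} p) =
  subst (_≤ 2 ^ suc (suc g)) (ℕₚ.*-suc 2 i) (ℕₚ.*-monoʳ-≤ 2 (<2^1+g p))

ancestor<2^g : ∀ {g i v} → Ancestor g i v → v < 2 ^ g
ancestor<2^g top          = ≤-refl
ancestor<2^g (even {g} p) = ≤-trans (ancestor<2^g p) (ℕₚ.m≤m+n (2 ^ g) _)
ancestor<2^g (odd p)      = <2^1+g p

-- On level g + 1, a left child has its ancestor below 2^g and a right child has its parent, which
-- is at least 2^g. So `v` reveals the kind of child; for right children it also fixes the index,
-- for left children the claim descends a level.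
Ancestor-injective : ∀ {g i j v} → Ancestor g i v → Ancestor g j v → i ≡ j
Ancestor-injective top      top      = refl
Ancestor-injective (even p) (even q) = cong (2 *_) (Ancestor-injective p q)
Ancestor-injective (even p) (odd q)  = contradiction (2^g≤ q) (ℕₚ.<⇒≱ (ancestor<2^g p))
Ancestor-injective (odd p)  (even q) = contradiction (2^g≤ p) (ℕₚ.<⇒≱ (ancestor<2^g q))
Ancestor-injective (odd p)  (odd q)  = refl

⌊2*n/2⌋ : ∀ n → ⌊ 2 * n /2⌋ ≡ n
⌊2*n/2⌋ n = trans (cong (λ m → ⌊ n + m /2⌋) (+-identityʳ n)) (sym (ℕₚ.n≡⌊n+n/2⌋ n))

⌊1+2*n/2⌋ : ∀ n → ⌊ suc (2 * n) /2⌋ ≡ n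
⌊1+2*n/2⌋ n = trans (cong (λ m → ⌊ suc (n + m) /2⌋) (+-identityʳ n)) (sym (ℕₚ.n≡⌈n+n/2⌉ n))

toℕ-parent : ∀ {j : Fin n} {m i} → toℕ j ≡ m → ⌊ m /2⌋ ≡ i → toℕ (parent j) ≡ i
toℕ-parent j≡ half≡ = trans (Finₚ.toℕ-fromℕ< _) (trans (cong ⌊_/2⌋ j≡) half≡)

rightIndex-noFlips : ∀ (v : Fin n) {i} → toℕ v ≡ i → rightIndex noFlips v ≡ suc (2 * i)
rightIndex-noFlips v refl =
  trans (cong (λ b → 2 * toℕ v + 1 ∸ bit b) (lookup-replicate v false)) (ℕₚ.+-comm _ 1)

dAncestorAcc-right : ∀ (j : Fin n) α i → toℕ j ≡ suc (2 * i) → toℕ (dAncestorAcc noFlips j α) ≡ i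
dAncestorAcc-right j@(suc _) (acc rs) i j≡
  rewrite dec-true (toℕ j ℕₚ.≟ rightIndex noFlips (parent j))
    (trans j≡ (sym (rightIndex-noFlips (parent j) (toℕ-parent j≡ (⌊1+2*n/2⌋ i)))))
  = toℕ-parent j≡ (⌊1+2*n/2⌋ i)

dAncestor-Ancestor : ∀ {g i v} → Ancestor g i v → ∀ (j : Fin n) α → toℕ j ≡ i →
                     toℕ (dAncestorAcc noFlips j α) ≡ v
dAncestor-Ancestor top             j α j≡ = dAncestorAcc-right j α 0 j≡
dAncestor-Ancestor (odd {i = i} p) j α j≡ = dAncestorAcc-right j α i j≡
dAncestor-Ancestor (even {g} p) zero α j≡ =
  contradiction (≤-trans (ℕₚ.m^n>0 2 (suc g)) (subst (2 ^ suc g ≤_) (sym j≡) (2^g≤ (even p)))) λ ()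
dAncestor-Ancestor (even {i = i} p) j@(suc _) (acc rs) j≡
  rewrite dec-false (toℕ j ℕₚ.≟ rightIndex noFlips (parent j))
    (λ j≡r → ℕₚ.1+n≢n (sym (trans (sym j≡)
      (trans j≡r (rightIndex-noFlips (parent j) (toℕ-parent j≡ (⌊2*n/2⌋ i)))))))
  = dAncestor-Ancestor p _ _ (toℕ-parent j≡ (⌊2*n/2⌋ i))

-- The initial schedule and the symmetric order.

module Layout (n : ℕ) .{{_ : NonZero n}} where

  -- Reduction modulo `n` makes the function total; in range it is the identity.
  nodeAt : ℕ → Fin n
  nodeAt i = i mod n

  toℕ-nodeAt : ∀ {i} → i < n → toℕ (nodeAt i) ≡ i
  toℕ-nodeAt i<n = trans (Finₚ.toℕ-fromℕ< _) (m<n⇒m%n≡m i<n)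

  -- The schedule for the heap with root v and slot i, whose subtree has height h.
  schedule : ℕ → Fin n → ℕ → Schedule n
  schedule zero    v i = built v leaf
  schedule (suc h) v i = todo (schedule h v (2 * i)) (nodeAt i) (schedule h (nodeAt i) (suc (2 * i)))

  -- The symmetric order, written the way mergesort cuts its input: the first half lists the heap
  -- formed by `v` and the left subtree, the second half the heap rooted at the node at `i`.
  order : ∀ h → Fin n → ℕ → Fin (2 ^ h) → Fin n
  order zero    v i _ = v
  order (suc h) v i p with remQuot {2} (2 ^ h) p
  ... | zero     , q = order h v (2 * i) q
  ... | suc zero , q = order h (nodeAt i) (suc (2 * i)) q

  module _ (h : ℕ) (v : Fin n) (i : ℕ) (q : Fin (2 ^ h)) where

    order-left : order (suc h) v i (combine {2} zero q) ≡ order h v (2 * i) q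
    order-left rewrite Finₚ.remQuot-combine {2} zero q = refl

    order-right : order (suc h) v i (combine {2} (suc zero) q) ≡ order h (nodeAt i) (suc (2 * i)) q
    order-right rewrite Finₚ.remQuot-combine {2} (suc zero) q = refl

  tabulate-order : ∀ h v i (f : Fin n → A) →
    List.tabulate (f ∘ order (suc h) v i) ≡
    List.tabulate (f ∘ order h v (2 * i)) ++ List.tabulate (f ∘ order h (nodeAt i) (suc (2 * i)))
  tabulate-order h v i f =
    trans (tabulate-combine (2 ^ h) (f ∘ order (suc h) v i))
      (cong₂ _++_ (tabulate-cong (cong f ∘ order-left h v i))
                  (tabulate-cong (cong f ∘ order-right h v i)))

  root-schedule : ∀ h v i → root (schedule h v i) ≡ v
  root-schedule zero    v i = refl
  root-schedule (suc h) v i = root-schedule h v (2 * i)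

  ∈⇒order : ∀ h {v i x} → x ∈ˢ schedule h v i → ∃ λ p → x ≡ order h v i p
  ∈⇒order zero    atRoot      = zero , refl
  ∈⇒order zero    (inTree ())
  ∈⇒order (suc h) (inLeft x∈) with ∈⇒order h x∈
  ... | q , refl = combine {2} zero q , sym (order-left h _ _ q)
  ∈⇒order (suc h) (inRight x∈) with ∈⇒order h x∈
  ... | q , refl = combine {2} (suc zero) q , sym (order-right h _ _ q)

  order∈ : ∀ h {v i} p → order h v i p ∈ˢ schedule h v i
  order∈ zero    p = atRoot
  order∈ (suc h) p with Finₚ.combine-surjective {2} {2 ^ h} p
  ... | zero     , q , refl = subst (_∈ˢ _) (sym (order-left h _ _ q)) (inLeft (order∈ h q))
  ... | suc zero , q , refl = subst (_∈ˢ _) (sym (order-right h _ _ q)) (inRight (order∈ h q))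

  ∈⇒todo : ∀ h {v i x} → x ∈ˢ schedule h v i → x ≢ v → x ∈ᵗ schedule h v i
  ∈⇒todo zero    atRoot       x≢v = contradiction refl x≢v
  ∈⇒todo zero    (inTree ())  x≢v
  ∈⇒todo (suc h) (inLeft x∈)  x≢v = inLeft (∈⇒todo h x∈ x≢v)
  ∈⇒todo (suc h) {i = i} {x} (inRight x∈) x≢v with x Finₚ.≟ nodeAt i
  ... | yes refl = here
  ... | no x≢c   = inRight (∈⇒todo h x∈ x≢c)

  module _ (k : ℕ) (n≡2^k : n ≡ 2 ^ k) where

    inBounds : ∀ {h g i v} → suc h + g ≡ k → Ancestor g i v → i < n
    inBounds {h} {g} refl anc = subst (_ <_) (sym n≡2^k)
      (≤-trans (<2^1+g anc) (ℕₚ.^-monoʳ-≤ 2 (s≤s (ℕₚ.m≤n+m g h))))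

    odd-nodeAt : ∀ {h g i v} → suc h + g ≡ k → Ancestor g i v →
                 Ancestor (suc g) (suc (2 * i)) (toℕ (nodeAt i))
    odd-nodeAt {i = i} eq anc = subst (Ancestor _ _) (sym (toℕ-nodeAt (inBounds eq anc))) (odd anc)

    -- The order lists the ancestors of the indices 2^h i, …, 2^h (i + 1) - 1 of
    -- level k, so it inherits its injectivity from Ancestor.
    order-Ancestor : ∀ h {g v i} → h + g ≡ k → Ancestor g i (toℕ v) → ∀ p →
                     Ancestor k (2 ^ h * i + toℕ p) (toℕ (order h v i p))
    order-Ancestor zero {i = i} refl anc zero =
      subst (λ j → Ancestor k j _) (sym (trans (+-identityʳ _) (+-identityʳ i))) anc
    order-Ancestor (suc h) {g} {v} {i} eq anc p with Finₚ.combine-surjective {2} {2 ^ h} p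
    ... | zero     , q , refl = subst₂ (Ancestor k)
            (trans (evenPosition (2 ^ h) i (toℕ q))
                   (cong (2 ^ suc h * i +_) (sym (Finₚ.toℕ-combine {2} zero q))))
            (cong toℕ (sym (order-left h v i q)))
            (order-Ancestor h (trans (ℕₚ.+-suc h g) eq) (even anc) q)
      where
      evenPosition : ∀ m i q → m * (2 * i) + q ≡ 2 * m * i + (m * 0 + q)
      evenPosition = solve-∀
    ... | suc zero , q , refl = subst₂ (Ancestor k)
            (trans (oddPosition (2 ^ h) i (toℕ q))
                   (cong (2 ^ suc h * i +_) (sym (Finₚ.toℕ-combine {2} (suc zero) q))))
            (cong toℕ (sym (order-right h v i q)))
            (order-Ancestor h (trans (ℕₚ.+-suc h g) eq) (odd-nodeAt {h} eq anc) q)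
      where
      oddPosition : ∀ m i q → m * suc (2 * i) + q ≡ 2 * m * i + (m * 1 + q)
      oddPosition = solve-∀

    order-injective : ∀ h {g v i} → h + g ≡ k → Ancestor g i (toℕ v) →
                      Injective _≡_ _≡_ (order h v i)
    order-injective h {i = i} eq anc {p} {q} p≡q = Finₚ.toℕ-injective (ℕₚ.+-cancelˡ-≡ (2 ^ h * i) _ _
      (Ancestor-injective (order-Ancestor h eq anc p)
        (subst (Ancestor k _) (cong toℕ (sym p≡q)) (order-Ancestor h eq anc q))))

    schedule-valid : ∀ h {g v i p} → h + g ≡ k → Ancestor g i (toℕ v) → toℕ p < i →
                     Valid noFlips (replicate n true) p i (schedule h v i)
    -- Height 0 is reached on level `k`, where indices are at least 2^k = n and so out of range: for
    -- a power of two all leaves lie on one level.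
    schedule-valid zero {i = i} refl anc _ = built (λ ())
      (leaf λ j j≡i → contradiction (subst₂ _≤_ (sym n≡2^k) (sym j≡i) (2^g≤ anc))
                                    (ℕₚ.<⇒≱ (Finₚ.toℕ<n j)))
    schedule-valid (suc h) {g} {v} {i} {p} eq anc p<i =
      todo c≡ (subst (toℕ p <_) (sym c≡) p<i) (lookup-replicate c true) (root-schedule h c _)
        (trans (Finₚ.toℕ-injective (dAncestor-Ancestor anc c _ c≡)) (sym (root-schedule h v _)))
        disjoint
        (subst (λ j → Valid _ _ c (2 * j) (schedule h v (2 * i))) (sym c≡)
          (schedule-valid h eq′ (even anc) (subst (_< 2 * i) (sym c≡) i<2*i)))
        (subst (λ j → Valid _ _ c (suc (2 * j)) (schedule h c (suc (2 * i)))) (sym c≡)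
          (schedule-valid h eq′ (odd-nodeAt {h} eq anc)
            (subst (_< suc (2 * i)) (sym c≡) (ℕₚ.m<n⇒m<1+n i<2*i))))
      where
      c   = nodeAt i
      c≡  = toℕ-nodeAt (inBounds {h} eq anc)
      eq′ = trans (ℕₚ.+-suc h g) eq
      i<2*i : i < 2 * i
      i<2*i = ℕₚ.m<m+n i (subst (0 <_) (sym (+-identityʳ i)) (≤-trans (ℕₚ.m^n>0 2 g) (2^g≤ anc)))
      -- A common index would be the ancestor of two indices of level `k`, yet those below 2i all
      -- precede those below 2i + 1.
      disjoint : Disjointˢ (schedule h v (2 * i)) (schedule h c (suc (2 * i)))
      disjoint x∈E x∈F with ∈⇒order h x∈E | ∈⇒order h x∈F
      ... | p , refl | q , p≡q = ℕₚ.<⇒≢ position< (Ancestor-injective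
              (order-Ancestor h eq′ (even anc) p)
              (subst (Ancestor k _) (cong toℕ (sym p≡q))
                (order-Ancestor h eq′ (odd-nodeAt {h} eq anc) q)))
        where
        open ℕₚ.≤-Reasoning
        position< : 2 ^ h * (2 * i) + toℕ p < 2 ^ h * suc (2 * i) + toℕ q
        position< = begin-strict
          2 ^ h * (2 * i) + toℕ p ≡⟨ ℕₚ.+-comm _ (toℕ p) ⟩
          toℕ p + 2 ^ h * (2 * i) <⟨ ℕₚ.+-monoˡ-< _ (Finₚ.toℕ<n p) ⟩
          2 ^ h + 2 ^ h * (2 * i) ≡⟨ ℕₚ.*-suc (2 ^ h) (2 * i) ⟨
          2 ^ h * suc (2 * i)     ≤⟨ ℕₚ.m≤m+n _ (toℕ q) ⟩
          2 ^ h * suc (2 * i) + toℕ q ∎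

    top-nodeAt : Ancestor 0 1 (toℕ (nodeAt 0))
    top-nodeAt =
      subst (Ancestor 0 1) (sym (toℕ-nodeAt (subst (0 <_) (sym n≡2^k) (ℕₚ.m^n>0 2 k)))) top

    heapOrder-injective : Injective _≡_ _≡_ (order k (nodeAt 0) 1)
    heapOrder-injective = order-injective k (+-identityʳ k) top-nodeAt

    ∈-schedule : ∀ x → x ∈ˢ schedule k (nodeAt 0) 1
    ∈-schedule x with injective⇒preimage (ℕₚ.≤-reflexive n≡2^k) heapOrder-injective x
    ... | p , refl = order∈ k p

-- Mergesort on the permuted input.

module _ (O : StrictTotalOrder a ℓ₁ ℓ₂) where
  open StrictTotalOrder O using (_≈_; module Eq) renaming (Carrier to V)
  open Merging O
  module V  = SetoidPermutation Eq.setoid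
  module Vₚ = SetoidPermutationₚ Eq.setoid

  mergeResults : (r₁ r₂ : List V × List (Comparison O)) → List V × List (Comparison O)
  mergeResults (vs₁ , cs₁) (vs₂ , cs₂) = mergeValues vs₁ vs₂ , cs₁ ++ cs₂ ++ mergeComparisons vs₁ vs₂

  -- The input is a variable `xs` with an equation, since `mergesortAcc` matches on two leading
  -- elements, which `ys ++ zs` does not display. Accessibility proofs are arbitrary because their
  -- type depends on the list.
  mergesort-++ : ∀ ys zs {r₁ r₂} → length ys ≡ length zs → 0 < length ys →
    (∀ α → mergesortAcc O ys α ≡ r₁) → (∀ α → mergesortAcc O zs α ≡ r₂) →
    ∀ {xs} α → xs ≡ ys ++ zs →
    mergesortAcc O xs α ≡ mergeResults r₁ r₂
  mergesort-++ ys zs {r₁} {r₂} l≡ 0<l ih₁ ih₂ {xs} = go xs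
    where
    2l≡ : ∀ {xs} → xs ≡ ys ++ zs → length xs ≡ 2 * length ys
    2l≡ xs≡ = trans (cong length xs≡)
      (trans (length-++ ys) (cong (length ys +_) (trans (sym l≡) (sym (+-identityʳ _)))))
    half≡ : ∀ {xs} → xs ≡ ys ++ zs → ⌊ length xs /2⌋ ≡ length ys
    half≡ xs≡ = trans (cong ⌊_/2⌋ (2l≡ xs≡)) (⌊2*n/2⌋ _)
    left : ∀ {ws} α → ws ≡ ys → mergesortAcc O ws α ≡ r₁
    left α refl = ih₁ α
    right : ∀ {ws} α → ws ≡ zs → mergesortAcc O ws α ≡ r₂
    right α refl = ih₂ α
    go : ∀ xs α → xs ≡ ys ++ zs → mergesortAcc O xs α ≡ mergeResults r₁ r₂
    go []       α xs≡ = contradiction (subst (0 <_) (sym (half≡ xs≡)) 0<l) λ ()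
    go (x ∷ []) α xs≡ = contradiction (subst (0 <_) (sym (half≡ xs≡)) 0<l) λ ()
    go xs@(_ ∷ _ ∷ _) (acc rs) xs≡ =
      cong₂ mergeResults
        (left _ (trans (cong₂ take (half≡ xs≡) xs≡) (take-length-++ ys zs)))
        (right _ (trans (cong₂ drop (half≡ xs≡) xs≡) (drop-length-++ ys zs)))

  module _ {n : ℕ} .{{_ : NonZero n}} (s : Vector V n) where
    open Layout n
    open Construction O n

    mergesort-schedule : ∀ h v i α →
      mergesortAcc O (List.tabulate (s ∘ order h v i)) α ≡
      (values (tabulate s) (schedule h v i) , future (tabulate s) (schedule h v i))
    mergesort-schedule zero    v i α = cong (λ x → x ∷ [] , []) (sym (lookup∘tabulate s v))
    mergesort-schedule (suc h) v i α = mergesort-++ _ _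
      (trans (length-tabulate (s ∘ order h v (2 * i)))
             (sym (length-tabulate (s ∘ order h (nodeAt i) (suc (2 * i))))))
      (subst (0 <_) (sym (length-tabulate (s ∘ order h v (2 * i)))) (ℕₚ.m^n>0 2 h))
      (mergesort-schedule h v (2 * i))
      (mergesort-schedule h (nodeAt i) (suc (2 * i)))
      α (tabulate-order h v i s)

    values-schedule : ∀ h v i →
      values (tabulate s) (schedule h v i) V.↭ List.tabulate (s ∘ order h v i)
    values-schedule zero    v i = V.↭-reflexive (cong [_] (lookup∘tabulate s v))
    values-schedule (suc h) v i =
      V.↭-trans (mergeValues-↭ (values (tabulate s) (schedule h v (2 * i))) _)
        (V.↭-trans
          (Vₚ.++⁺ (values-schedule h v (2 * i)) (values-schedule h (nodeAt i) (suc (2 * i))))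
          (V.↭-reflexive (sym (tabulate-order h v i s))))

  weakHeapsort-mergesort : ∀ k {n} .{{_ : NonZero n}} (n≡2^k : n ≡ 2 ^ k) (s : Vector V n) →
    Injective _≡_ _≈_ s →
    SameComparisons O (weakHeapsortComparisons O s)
                      (mergesortComparisons O (s ∘ Layout.order n k (Layout.nodeAt n 0) 1))
  weakHeapsort-mergesort k {suc n} n≡2^k s s-inj =
    subst (SameComparisons O (weakHeapsortComparisons O s))
      (sym (cong proj₂ (mergesort-schedule s k (nodeAt 0) 1 _)))
      -- The two blanks are `values` and `future` of the initial schedule, in which every join is
      -- outstanding.
      (sort-comparisons _ _
        (Vₚ.Unique-resp-↭ (V.↭-sym values↭)
          (AllPairsₚ.tabulate⁺ λ i≢j eq → i≢j (heapOrder-injective k n≡2^k (s-inj eq))))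
        (trans (Vₚ.xs↭ys⇒|xs|≡|ys| values↭) (trans (length-tabulate _) (sym n≡2^k)))
        s
        (record
          { schedule   = schedule k (nodeAt 0) 1
          ; valid      = schedule-valid k n≡2^k k (+-identityʳ k) (top-nodeAt k n≡2^k) ≤-refl
          ; root≡      = trans (root-schedule k (nodeAt 0) 1) 0≡
          ; values≡    = refl
          ; future↭    = SetoidPermutation.↭-refl comparisonSetoid
          ; todo<      = λ {x} _ → Finₚ.toℕ<n x
          ; todo≥      = λ {x} x≢0 _ → ∈⇒todo k (∈-schedule k n≡2^k x) (λ x≡ → x≢0 (trans x≡ 0≡))
          ; unflipped  = λ {x} _ → lookup-replicate x false
          ; rootActive = refl
          }))
    where
    open Layout (suc n)
    open Sorting O n
    values↭ = values-schedule s k (nodeAt 0) 1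
    0≡ : nodeAt 0 ≡ zero
    0≡ = Finₚ.toℕ-injective (toℕ-nodeAt (s≤s z≤n))

theorem3 : ∀ {a ℓ₁ ℓ₂} (k : ℕ) →
    ∃ λ (π : Permutation′ (2 ^ k)) →
    (O : StrictTotalOrder a ℓ₁ ℓ₂) →
    (s : Vector (StrictTotalOrder.Carrier O) (2 ^ k)) →
    Injective _≡_ (StrictTotalOrder._≈_ O) s →
    SameComparisons O
    (weakHeapsortComparisons O s)
    (mergesortComparisons O (λ i → s (π ⟨$⟩ʳ i)))
theorem3 k =
  -- `order` involves indices only, so the permutation is fixed before the order and the input are
  -- given.
  injective⇒permutation (Layout.heapOrder-injective (2 ^ k) {{ℕₚ.m^n≢0 2 k}} k refl) ,
  λ O → weakHeapsort-mergesort O k {{ℕₚ.m^n≢0 2 k}} refl
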